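{- Let $m\ge 1$ and $1\le i\le m$. For all sufficiently large positive integers $q$, the number of points $(x_1,\dots,x_m)\in\mathbb{Z}_q^m$ with $x_i=1$ that lie on no hyperplane $H'_q$ with $H'\in\mathcal{B}_m\setminus\{\{x_i=1\}\}$ equals $$(q-2m)^{i-1}(q-2m+1)^{m-i}.$$ That is, $|M((\mathcal{B}_m^{\{x_i=1\}})_q)|=(q-2m)^{i-1}(q-2m+1)^{m-i}$.
   Context: For $m\ge1$, the Shi arrangement of type B is the set of affine hyperplanes in $\mathbb{R}^m$ $$\mathcal{B}_m=\{\{x_s=0\},\{x_s=1\}\mid s\in[m]\}\cup\{\{x_s\pm x_t=0\},\{x_s\pm x_t=1\}\mid 1\le s<t\le m\},$$ where $[m]=\{1,\dots,m\}$. For a positive integer $q$ and a hyperplane $H=\{a_1x_1+\dots+a_mx_m=b\}$ with integer coefficients, $H_q=\{x\in\mathbb{Z}_q^m : [a_1]_qx_1+\dots+[a_m]_qx_m=[b]_q\}$ is its reduction modulo $q$, with $\mathbb{Z}_q=\mathbb{Z}/q\mathbb{Z}$. For $H\in\mathcal{B}_m$, the restriction is $\mathcal{B}_m^H=\{H\cap H' : H'\in\mathcal{B}_m\setminus\{H\},\ H\cap H'\neq\emptyset\}$, and $|M((\mathcal{B}_m^H)_q)|$ denotes the number of points of $H_q$ not lying on any $H'_q$ with $H'\in\mathcal{B}_m\setminus\{H\}$ (the characteristic quasi-polynomial of the restriction). -}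

module Defs where

open import Data.Nat as ℕ using (ℕ; zero; suc; NonZero; _∸_)
open import Data.Integer as ℤ using (ℤ; +_; -_)
open import Data.Integer.DivMod using (_%ℕ_)
import Data.Integer.Properties as ℤP
open import Data.Fin using (Fin; toℕ; _<_)
import Data.Fin.Properties as FinP
open import Data.Vec using (Vec; []; _∷_; lookup; replicate; updateAt; tabulate)
import Data.Vec.Properties as VecP
open import Data.List using (List; []; _∷_; map; concatMap; filter; length; _++_; allFin)
open import Data.Product using (_×_; _,_; proj₁; proj₂)
import Data.Product.Properties as ProdP
open import Relation.Binary.PropositionalEquality using (_≡_)
open import Relation.Nullary using (Dec; ¬_; yes; no)

open import Relation.Nullary.Decidable using (_×-dec_; ¬?)
open import Data.List.Relation.Unary.All using (All)
import Data.List.Relation.Unary.All as All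

-- An affine hyperplane  a₁x₁ + … + aₘxₘ = b  with integer coefficients,
-- represented by its coefficient vector and right-hand side.
Hyperplane : ℕ → Set
Hyperplane m = Vec ℤ m × ℤ

_≟H_ : ∀ {m} (H H' : Hyperplane m) → Dec (H ≡ H')
_≟H_ = ProdP.≡-dec (VecP.≡-dec ℤP._≟_) ℤP._≟_

unit : ∀ {m} → Fin m → ℤ → Vec ℤ m
unit s a = updateAt (replicate _ (+ 0)) s (λ _ → a)

pair : ∀ {m} → Fin m → Fin m → ℤ → Vec ℤ m
pair s t c = updateAt (unit s (+ 1)) t (λ _ → c)

pairsLt : (m : ℕ) → List (Fin m × Fin m)
pairsLt m = filter (λ p → proj₁ p Data.Fin.<? proj₂ p)
  (concatMap (λ s → map (λ t → s , t) (allFin m)) (allFin m))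

shiB : (m : ℕ) → List (Hyperplane m)
shiB m =
  concatMap (λ s → (unit s (+ 1) , + 0) ∷ (unit s (+ 1) , + 1) ∷ []) (allFin m)
  ++ concatMap (λ p → let s = proj₁ p ; t = proj₂ p in
       (pair s t (+ 1) , + 0) ∷ (pair s t (+ 1) , + 1)
       ∷ (pair s t (- + 1) , + 0) ∷ (pair s t (- + 1) , + 1) ∷ [])
     (pairsLt m)

-- points of ℤ_q^m, with ℤ_q = Fin q (residues 0,…,q-1)
allPoints : (q m : ℕ) → List (Vec (Fin q) m)
allPoints q zero = [] ∷ []
allPoints q (suc m) = concatMap (λ a → map (a ∷_) (allPoints q m)) (allFin q)

evalH : ∀ {m q} → Hyperplane m → Vec (Fin q) m → ℤ
evalH {zero} ([] , b) [] = ℤ.- b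
evalH {suc m} ((a ∷ as) , b) (x ∷ xs) = a ℤ.* (+ toℕ x) ℤ.+ evalH (as , b) xs

_∈Hq_ : ∀ {m q} .{{_ : NonZero q}} → Vec (Fin q) m → Hyperplane m → Set
_∈Hq_ {q = q} x H = (evalH H x %ℕ q) ≡ 0

_∈Hq?_ : ∀ {m q} .{{_ : NonZero q}} (x : Vec (Fin q) m) (H : Hyperplane m) → Dec (x ∈Hq H)
_∈Hq?_ {q = q} x H = (evalH H x %ℕ q) ℕ.≟ 0

shiBWithout : ∀ m → Hyperplane m → List (Hyperplane m)
shiBWithout m H = filter (λ H' → ¬? (H' ≟H H)) (shiB m)

restrictionCount : (m q : ℕ) .{{_ : NonZero q}} → Hyperplane m → ℕ
restrictionCount m q H = length (filter
  (λ x → (x ∈Hq? H) ×-dec All.all? (λ H' → ¬? (x ∈Hq? H')) (shiBWithout m H))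
  (allPoints q m))

coordOne : ∀ {m} → Fin m → Hyperplane m
coordOne i = unit i (+ 1) , + 1

{-# OPTIONS --safe #-}

-- Put M = 2m, number the coordinates s = 0, …, m−1 and encode x_s ∈ {0, …, q−1} by the integer
-- y_s = M x_s + s.  Points with all x_s ≠ 0 avoid the hyperplanes x_s ± x_t = 0, 1 exactly when,
-- for s ≠ t, y_s has distance ≥ M from y_t and from its mirror image under y ↦ M(q+1) − 1 − y.
-- Up to this reflection every integer z in [M, m(q+1)) encodes exactly one pair (s, x_s); here s
-- depends only on z mod M, and each block of m consecutive integers contains every s once.
-- So the coordinates s ≠ i have to be placed at mutual distance ≥ M above the slot M + i of x_i = 1.
-- Scanning z upwards, one either leaves z empty or fills it and jumps to z + M.  By induction the
-- number of placements is the product over s of the number of slots of s in the interval shortened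
-- by M for all but one of the coordinates, which is q − 2m for s < i and q − 2m + 1 for s > i.
module Submission where

open import Defs
open import Data.Nat using (ℕ; zero; suc; pred; _+_; _≤_; _<_; _∸_; _*_; _^_; _/_; _%_; NonZero;
  z≤n; s≤s; s≤s⁻¹; _≤?_; _<?_; >-nonZero; >-nonZero⁻¹)
open import Data.Nat.DivMod
open import Data.Nat.Properties
open import Data.Nat.Tactic.RingSolver using (solve; solve-∀)
open import Data.List as List using (List; []; _∷_; length; filter; cartesianProductWith; allFin)
open import Data.Product using (∃; _×_; _,_; proj₁; proj₂)
open import Data.Sum using (_⊎_; inj₁; inj₂; [_,_]′)
open import Function using (_∘_; case_of_)
open import Relation.Nullary using (¬_; Dec; yes; no; does; contradiction)
open import Relation.Nullary.Decidable using (_×-dec_; _⊎-dec_; _→-dec_; ¬?)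
open import Relation.Unary using (Decidable; _≐_)
open import Relation.Binary.Definitions using (tri<; tri≈; tri>)
open import Relation.Binary.PropositionalEquality

-- Inequalities from linear certificates

abstract
  -- A linear certificate: `a ≤ b` is the sum of the available inequalities, `k` is the slack, and
  -- the equation says that h - g equals b - a + k. In `infeasible` the same sum is refuted by `a`
  -- exceeding `b`.
  linear : ∀ {a b g h} k → a ≤ b → g + b + k ≡ h + a → g ≤ h
  linear {a} {b} {g} {h} k a≤b eq =
    +-cancelʳ-≤ b g h (≤-trans (≤-trans (m≤m+n (g + b) k) (≤-reflexive eq)) (+-monoʳ-≤ h a≤b))

  infeasible : ∀ {a b} {X : Set} k → a ≤ b → b + suc k ≡ a → X
  infeasible {b = b} k a≤b refl = contradiction a≤b (m+1+n≰m b)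

*-swap : ∀ a b c → a * (b * c) ≡ b * (a * c)
*-swap a b c = solve (a ∷ b ∷ c ∷ [])

-- Intervals and distances under a reflection

module Reflection (M h : ℕ) where

  -- y is z or its mirror image 2h − 1 − z.
  AtEnd : ℕ → ℕ → Set
  AtEnd z y = y ≡ z ⊎ suc (y + z) ≡ h + h

  -- The closed interval from z to its mirror image 2h - 1 - z, whose endpoints are described by
  -- `AtEnd`.
  Between : ℕ → ℕ → Set
  Between z y = z ≤ y × y + z < h + h

  -- The second factor compares `w` with the mirror image 2h - 1 - y; terms are moved across to
  -- avoid truncated subtraction.
  Apart : ℕ → ℕ → Set
  Apart w y = (w + M ≤ y ⊎ y + M ≤ w) × (w + y + M < h + h ⊎ h + h + M ≤ suc (w + y))

  Apart? : ∀ w y → Dec (Apart w y)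
  Apart? w y = ((w + M ≤? y) ⊎-dec (y + M ≤? w)) ×-dec ((w + y + M <? h + h) ⊎-dec (h + h + M ≤? suc (w + y)))

  Between? : ∀ z y → Dec (Between z y)
  Between? z y = (z ≤? y) ×-dec (y + z <? h + h)

  apart-sym : ∀ {w y} → Apart w y → Apart y w
  apart-sym {w} {y} (d , r) =
    [ inj₂ , inj₁ ]′ d , subst (λ k → k + M < h + h ⊎ h + h + M ≤ suc k) (+-comm w y) r

  between-weaken : ∀ {l z y} → l ≤ z → Between z y → Between l y
  between-weaken {y = y} l≤z (z≤y , yz<) = ≤-trans l≤z z≤y , ≤-<-trans (+-monoʳ-≤ y l≤z) yz<

  between-tighten : ∀ {z y} → Between z y → ¬ AtEnd z y → Between (suc z) y
  between-tighten {z} {y} (z≤y , yz<) ¬end =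
    ≤∧≢⇒< z≤y (¬end ∘ inj₁ ∘ sym) ,
    subst (_< h + h) (sym (+-suc y z)) (≤∧≢⇒< yz< (¬end ∘ inj₂))

  between-suc⇒¬AtEnd : ∀ {z y} → Between (suc z) y → ¬ AtEnd z y
  between-suc⇒¬AtEnd (z<y , _) (inj₁ refl) = n≮n _ z<y
  between-suc⇒¬AtEnd {z} {y} (_ , yz<) (inj₂ eq) = <⇒≢ yz< (trans (+-suc y z) eq)

  double-< : ∀ {z} → z + z < h + h → z < h
  double-< {z} zz< = ≰⇒> λ h≤z → <⇒≱ zz< (+-mono-≤ h≤z h≤z)

  between⇒< : ∀ {z y} → Between z y → z < h
  between⇒< {z = z} (z≤y , yz<) = double-< (≤-<-trans (+-monoˡ-≤ z z≤y) yz<)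

  atEnd⇒between : ∀ {z y} → z < h → AtEnd z y → Between z y
  atEnd⇒between z<h (inj₁ refl) = ≤-refl , +-mono-< z<h z<h
  atEnd⇒between {z} {y} z<h (inj₂ eq) =
    +-cancelʳ-≤ (suc z) z y (≤-trans (+-monoˡ-≤ (suc z) (<⇒≤ z<h)) (≤-trans (+-monoʳ-≤ h z<h)
      (≤-reflexive (trans (sym eq) (sym (+-suc y z)))))) ,
    ≤-reflexive eq

  atEnd⇒apart : ∀ {z w y} → AtEnd z w → Between (z + M) y → Apart w y
  atEnd⇒apart {z} {w} {y} (inj₁ refl) (zM≤y , yzM<) =
    inj₁ zM≤y , inj₁ (linear 0 yzM< (solve (z ∷ M ∷ y ∷ h ∷ [])))
  atEnd⇒apart {z} {w} {y} (inj₂ eq) (zM≤y , yzM<) =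
    inj₂ (linear 0 (+-mono-≤ yzM< (≤-reflexive (sym eq))) (solve (z ∷ M ∷ y ∷ w ∷ h ∷ []))) ,
    inj₂ (linear 0 (+-mono-≤ zM≤y (≤-reflexive (sym eq))) (solve (z ∷ M ∷ y ∷ w ∷ h ∷ [])))

  -- A position at distance M or more from `w` on the outer side would fall outside the interval of
  -- `l`, because `z < l + M`; these are the `infeasible` cases. What remains is the inner side. The
  -- freedom in `l` serves the start of the scan, where z exceeds `l` by i.
  apart⇒between : ∀ {z l w y} → AtEnd z w → Between l y → z < l + M → Apart w y →
    Between (z + M) y
  apart⇒between {z} {l} {w} {y} (inj₁ refl) (l≤y , yl<) z<lM (inj₂ yM≤z , _) =
    infeasible 0 (+-mono-≤ (+-mono-≤ l≤y z<lM) yM≤z) (solve (l ∷ M ∷ z ∷ y ∷ []))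
  apart⇒between {z} {l} {w} {y} (inj₁ refl) (l≤y , yl<) z<lM (inj₁ _ , inj₂ le) =
    infeasible 0 (+-mono-≤ (+-mono-≤ yl< z<lM) le) (solve (h ∷ l ∷ M ∷ z ∷ y ∷ []))
  apart⇒between {z} {l} {w} {y} (inj₁ refl) (l≤y , yl<) z<lM (inj₁ zM≤y , inj₁ lt) =
    zM≤y , linear 0 lt (solve (z ∷ M ∷ y ∷ h ∷ []))
  apart⇒between {z} {l} {w} {y} (inj₂ eq) (l≤y , yl<) z<lM (_ , inj₁ lt) =
    infeasible 0 (+-mono-≤ (+-mono-≤ (+-mono-≤ l≤y z<lM) lt) (≤-reflexive (sym eq)))
      (solve (l ∷ M ∷ z ∷ y ∷ w ∷ h ∷ []))
  apart⇒between {z} {l} {w} {y} (inj₂ eq) (l≤y , yl<) z<lM (inj₁ wM≤y , inj₂ _) =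
    infeasible 0 (+-mono-≤ (+-mono-≤ (+-mono-≤ yl< z<lM) wM≤y) (≤-reflexive (sym eq)))
      (solve (l ∷ M ∷ z ∷ y ∷ w ∷ h ∷ []))
  apart⇒between {z} {l} {w} {y} (inj₂ eq) (l≤y , yl<) z<lM (inj₂ yM≤w , inj₂ le) =
    linear 0 (+-mono-≤ le (≤-reflexive eq)) (solve (z ∷ M ∷ y ∷ w ∷ h ∷ [])) ,
    linear 0 (+-mono-≤ yM≤w (≤-reflexive eq)) (solve (z ∷ M ∷ y ∷ w ∷ h ∷ []))

-- Ring identities for the certificates and the encoding

abstract
  label-high-<-identity : ∀ m r → 2 * m + r + 0 ≡ r + m + m
  label-high-<-identity = solve-∀
  mixed-<-identity : ∀ m s t → suc (suc (t + s)) + (m + m) + 0 ≡ 2 * m + (suc s + suc t)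
  mixed-<-identity = solve-∀
  mixed-identity : ∀ m w v t s → 2 * m * (w + v) + suc (t + s) ≡ suc (2 * m * w + t + (2 * m * v + s))
  mixed-identity = solve-∀
  h+h-identity : ∀ m a → m * a + m * a ≡ 2 * m * a + 0
  h+h-identity = solve-∀
  half-quotient-identity : ∀ m j → m * (2 * j) ≡ j * (2 * m)
  half-quotient-identity = solve-∀
  decode-identity : ∀ M k j l r → suc (M * k + l + (r + j * M)) ≡ M * (k + j) + (l + suc r)
  decode-identity = solve-∀
  two-blocks-identity : ∀ m j → m * suc (suc j) ≡ m * j + 2 * m
  two-blocks-identity = solve-∀
  offset-identity : ∀ M i k → i + M + M + M * k ≡ suc (suc k) * M + i
  offset-identity = solve-∀

  separated-identity₁ : ∀ M a b s t → M * a + s + M + (M * b + t) + 0 ≡ M * b + t + (M * suc a + s)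
  separated-identity₁ = solve-∀
  separated-identity₂ : ∀ M a b s t → M * b + t + M + (M * a + M) + s ≡ M * a + s + (M * suc (suc b) + t)
  separated-identity₂ = solve-∀
  separated-identity₃ : ∀ m q a b s t → suc (2 * m * a + s + (2 * m * b + t) + 2 * m) + (2 * m * q + (m + m)) + 1
    ≡ m * suc q + m * suc q + (2 * m * suc (a + b) + (suc s + suc t))
  separated-identity₃ = solve-∀
  separated-identity₄ : ∀ m q a b s t → m * suc q + m * suc q + 2 * m + 2 * m * (a + b) + suc (s + t)
    ≡ suc (2 * m * a + s + (2 * m * b + t)) + 2 * m * suc (suc q)
  separated-identity₄ = solve-∀
  apart-identity₁ : ∀ m a s t → 2 * m * a + t + m + suc (s + m) ≡ 2 * m * a + s + 2 * m + suc t
  apart-identity₁ = solve-∀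
  apart-identity₂ : ∀ M a s t → M * a + s + t + suc M ≡ M * a + t + M + suc s
  apart-identity₂ = solve-∀
  apart-identity₃ : ∀ m b s t → 2 * m * b + t + m + suc (m + m + m + s) ≡ 2 * m * suc b + s + 2 * m + suc t
  apart-identity₃ = solve-∀
  apart-identity₄ : ∀ M b s t → M * suc b + s + t + 1 ≡ M * b + t + M + suc s
  apart-identity₄ = solve-∀
  apart-identity₅ : ∀ m a b s t → m * suc (a + b) + m * suc (a + b) + suc (s + t)
    ≡ suc (2 * m * a + s + (2 * m * b + t) + 2 * m)
  apart-identity₅ = solve-∀
  apart-identity₆ : ∀ m a b s t → suc (2 * m * a + s + (2 * m * b + t)) + (m + m) + suc (m + m)
    ≡ m * suc (a + b) + m * suc (a + b) + 2 * m + (suc s + suc t)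
  apart-identity₆ = solve-∀
  apart-identity₇ : ∀ m a b s t → m * (a + b) + m * (a + b) + suc (s + t + 2 * m)
    ≡ suc (2 * m * a + s + (2 * m * b + t) + 2 * m)
  apart-identity₇ = solve-∀
  apart-identity₈ : ∀ m a b s t → suc (2 * m * a + s + (2 * m * b + t)) + (m + m) + 1
    ≡ m * (a + b) + m * (a + b) + 2 * m + (suc s + suc t)
  apart-identity₈ = solve-∀
  inside-identity : ∀ m q c s → suc (2 * m * c + s + 2 * m) + (2 * m * q + 2 * m) + 0
    ≡ m * suc q + m * suc q + (2 * m * suc c + suc s)
  inside-identity = solve-∀

-- Imported only here: the variable lists of solve need an unambiguous _∷_.
open import Data.Bool using (if_then_else_)
open import Data.Fin as Fin using (Fin; toℕ; fromℕ<)
import Data.Fin.Properties as Fin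
open import Data.Maybe using (Maybe; just; nothing)
open import Data.Vec as Vec using (Vec; []; _∷_; lookup; _[_]≔_)
import Data.Vec.Properties as Vec
import Data.List.Properties as List
open import Data.List.Membership.Propositional using (_∈_; lose; find)
open import Data.List.Membership.Propositional.Properties using (∈-allFin; ∈-cartesianProductWith⁺;
  ∈-++⁺ˡ; ∈-++⁺ʳ; ∈-++⁻; ∈-concatMap⁺; ∈-concatMap⁻; ∈-filter⁺; ∈-filter⁻; ∈-map⁺)
open import Data.List.Relation.Unary.All as All using (All; []; _∷_)
open import Data.List.Relation.Unary.AllPairs using ([]; _∷_)
open import Data.List.Relation.Unary.Any using (here; there)
open import Data.List.Relation.Unary.Unique.Propositional using (Unique)
open import Data.List.Relation.Unary.Unique.Propositional.Properties using (allFin⁺; cartesianProductWith⁺)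

-- Counting in filtered lists and enumerating points

module _ {A : Set} {P Q : A → Set} (P? : Decidable P) (Q? : Decidable Q) where

  filter-split : ∀ xs → length (filter P? xs) ≡
    length (filter (λ x → P? x ×-dec Q? x) xs) + length (filter (λ x → P? x ×-dec ¬? (Q? x)) xs)
  filter-split [] = refl
  filter-split (x ∷ xs) with P? x | Q? x
  ... | no _  | _     = filter-split xs
  ... | yes _ | yes _ = cong suc (filter-split xs)
  ... | yes _ | no _  = trans (cong suc (filter-split xs)) (sym (+-suc _ _))

  length-filter-≐ : P ≐ Q → ∀ xs → length (filter P? xs) ≡ length (filter Q? xs)
  length-filter-≐ P≐Q xs = cong length (List.filter-≐ P? Q? P≐Q xs)

length-filter-singleton : ∀ {A : Set} {P : A → Set} (P? : Decidable P) {v xs} → Unique xs → v ∈ xs →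
  P v → (∀ {x} → P x → x ≡ v) → length (filter P? xs) ≡ 1
length-filter-singleton P? {v} {x ∷ xs} (x∉ ∷ _) (here refl) Pv only =
  trans (cong length (List.filter-accept P? {xs = xs} Pv))
    (cong (suc ∘ length) (List.filter-none P? (All.map (λ v≢y Py → v≢y (sym (only Py))) x∉)))
length-filter-singleton P? {v} {x ∷ xs} (x∉ ∷ u) (there v∈) Pv only =
  trans (cong length (List.filter-reject P? (λ Px → All.lookup x∉ v∈ (only Px))))
    (length-filter-singleton P? u v∈ Pv only)

concatMap-map : ∀ {A B C : Set} (f : A → B → C) xs ys →
  List.concatMap (λ a → List.map (f a) ys) xs ≡ cartesianProductWith f xs ys
concatMap-map f []       ys = refl
concatMap-map f (x ∷ xs) ys = cong (List.map (f x) ys List.++_) (concatMap-map f xs ys)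

allPoints-unique : ∀ q m → Unique (allPoints q m)
allPoints-unique q zero    = [] ∷ []
allPoints-unique q (suc m) = subst Unique (sym (concatMap-map _∷_ (allFin q) (allPoints q m)))
  (cartesianProductWith⁺ _∷_ Vec.∷-injective (allFin⁺ q) (allPoints-unique q m))

∈-allPoints : ∀ {q m} (x : Vec (Fin q) m) → x ∈ allPoints q m
∈-allPoints [] = here refl
∈-allPoints {q} {suc m} (a ∷ x) = subst (_ ∈_) (sym (concatMap-map _∷_ (allFin q) (allPoints q m)))
  (∈-cartesianProductWith⁺ _∷_ (∈-allFin a) (∈-allPoints x))

-- Partial assignments and products over open coordinates

module _ {X : Set} where

  openings : ∀ {m} → Vec (Maybe X) m → ℕ
  openings []            = 0
  openings (just _ ∷ A)  = openings A
  openings (nothing ∷ A) = suc (openings A)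

  prodOpen : ∀ {m} → Vec (Maybe X) m → (Fin m → ℕ) → ℕ
  prodOpen []            f = 1
  prodOpen (just _ ∷ A)  f = prodOpen A (f ∘ Fin.suc)
  prodOpen (nothing ∷ A) f = f Fin.zero * prodOpen A (f ∘ Fin.suc)

  prodOpen-cong : ∀ {m} (A : Vec (Maybe X) m) {f g} →
    (∀ s → lookup A s ≡ nothing → f s ≡ g s) → prodOpen A f ≡ prodOpen A g
  prodOpen-cong []            f≗g = refl
  prodOpen-cong (just _ ∷ A)  f≗g = prodOpen-cong A (f≗g ∘ Fin.suc)
  prodOpen-cong (nothing ∷ A) f≗g = cong₂ _*_ (f≗g Fin.zero refl) (prodOpen-cong A (f≗g ∘ Fin.suc))

  prodOpen-assign : ∀ {m} (A : Vec (Maybe X) m) {s} v f → lookup A s ≡ nothing →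
    prodOpen A f ≡ f s * prodOpen (A [ s ]≔ just v) f
  prodOpen-assign (nothing ∷ A) {Fin.zero}  v f refl = refl
  prodOpen-assign (just _ ∷ A)  {Fin.suc s} v f eq   = prodOpen-assign A v (f ∘ Fin.suc) eq
  prodOpen-assign (nothing ∷ A) {Fin.suc s} v f eq   = trans
    (cong (f Fin.zero *_) (prodOpen-assign A v (f ∘ Fin.suc) eq))
    (*-swap (f Fin.zero) (f (Fin.suc s)) (prodOpen (A [ s ]≔ just v) (f ∘ Fin.suc)))

  openings-assign : ∀ {m} (A : Vec (Maybe X) m) {s} v → lookup A s ≡ nothing →
    openings A ≡ suc (openings (A [ s ]≔ just v))
  openings-assign (nothing ∷ A) {Fin.zero}  v refl = refl
  openings-assign (just _ ∷ A)  {Fin.suc s} v eq   = openings-assign A v eq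
  openings-assign (nothing ∷ A) {Fin.suc s} v eq   = cong suc (openings-assign A v eq)

  openings-zero : ∀ {m} (A : Vec (Maybe X) m) → openings A ≡ 0 →
    ∃ λ x → ∀ s → lookup A s ≡ just (lookup x s)
  openings-zero []           _  = [] , λ ()
  openings-zero (just v ∷ A) eq with x , A≡x ← openings-zero A eq =
    v ∷ x , λ { Fin.zero → refl ; (Fin.suc s) → A≡x s }

  openings-suc : ∀ {m u} (A : Vec (Maybe X) m) → openings A ≡ suc u → ∃ λ s → lookup A s ≡ nothing
  openings-suc (just _ ∷ A)  eq with s , A≡ ← openings-suc A eq = Fin.suc s , A≡
  openings-suc (nothing ∷ A) eq = Fin.zero , refl

  prodOpen-full : ∀ {m} (A : Vec (Maybe X) m) f → openings A ≡ 0 → prodOpen A f ≡ 1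
  prodOpen-full []           f _  = refl
  prodOpen-full (just _ ∷ A) f eq = prodOpen-full A (f ∘ Fin.suc) eq

  prodOpen-zero : ∀ {m u} (A : Vec (Maybe X) m) f → openings A ≡ suc u → (∀ s → f s ≡ 0) →
    prodOpen A f ≡ 0
  prodOpen-zero (just _ ∷ A)  f eq f≗0 = prodOpen-zero A (f ∘ Fin.suc) eq (f≗0 ∘ Fin.suc)
  prodOpen-zero (nothing ∷ A) f eq f≗0 = cong (_* prodOpen A (f ∘ Fin.suc)) (f≗0 Fin.zero)

  lookup-assign-nothing : ∀ {m} (A : Vec (Maybe X) m) s {v t} →
    lookup (A [ s ]≔ just v) t ≡ nothing → t ≢ s × lookup A t ≡ nothing
  lookup-assign-nothing A s {v} {t} eq with t Fin.≟ s
  ... | no t≢s   = t≢s , trans (sym (Vec.lookup∘update′ t≢s A (just v))) eq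
  ... | yes refl with () ← trans (sym (Vec.lookup∘update s A (just v))) eq

  lookup-assign-just : ∀ {m} (A : Vec (Maybe X) m) s {v t w} →
    lookup (A [ s ]≔ just v) t ≡ just w → (t ≡ s × w ≡ v) ⊎ (t ≢ s × lookup A t ≡ just w)
  lookup-assign-just A s {v} {t} eq with t Fin.≟ s
  ... | no t≢s   = inj₂ (t≢s , trans (sym (Vec.lookup∘update′ t≢s A (just v))) eq)
  ... | yes refl with refl ← trans (sym (Vec.lookup∘update s A (just v))) eq = inj₁ (refl , refl)

  openings-replicate : ∀ m → openings (Vec.replicate m (nothing {A = X})) ≡ m
  openings-replicate zero    = refl
  openings-replicate (suc m) = cong suc (openings-replicate m)

  prodOpen-replicate : ∀ m f b → (∀ s → f s ≡ b) → prodOpen (Vec.replicate m (nothing {A = X})) f ≡ b ^ m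
  prodOpen-replicate zero    f b f≡b = refl
  prodOpen-replicate (suc m) f b f≡b = cong₂ _*_ (f≡b Fin.zero) (prodOpen-replicate m (f ∘ Fin.suc) b (f≡b ∘ Fin.suc))

  prodOpen-all-but-one : ∀ {m} (i : Fin m) (v : X) f a b →
    (∀ s → toℕ s < toℕ i → f s ≡ a) → (∀ s → toℕ i < toℕ s → f s ≡ b) →
    prodOpen (Vec.replicate m nothing [ i ]≔ just v) f ≡ a ^ toℕ i * b ^ (m ∸ suc (toℕ i))
  prodOpen-all-but-one {suc m} Fin.zero v f a b below above =
    trans (prodOpen-replicate m (f ∘ Fin.suc) b (λ s → above (Fin.suc s) (s≤s z≤n))) (sym (+-identityʳ _))
  prodOpen-all-but-one {suc m} (Fin.suc i) v f a b below above = trans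
    (cong₂ _*_ (below Fin.zero (s≤s z≤n)) (prodOpen-all-but-one i v (f ∘ Fin.suc) a b
      (λ s → below (Fin.suc s) ∘ s≤s) (λ s → above (Fin.suc s) ∘ s≤s)))
    (sym (*-assoc a _ _))

-- Scanning the slots upwards

module Placement {m q : ℕ} (M h : ℕ) (pos : Fin m → Fin q → ℕ) (label : ℕ → Fin m)
  (label-periodic : ∀ z → label (z + M) ≡ label z)
  (0<M : 0 < M)
  (decode : ∀ z → M ≤ z → z < h → ∃ λ v → Reflection.AtEnd M h z (pos (label z) v) ×
              (∀ s w → Reflection.AtEnd M h z (pos s w) → s ≡ label z × w ≡ v))
  where

  open Reflection M h

  hit : Fin m → ℕ → ℕ
  hit s z = if does (label z Fin.≟ s) then 1 else 0

  -- The last argument is a length: the slots examined are z, ..., z + d - 1.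
  hits : Fin m → ℕ → ℕ → ℕ
  hits s z zero    = 0
  hits s z (suc d) = hit s z + hits s (suc z) d

  hits-own : ∀ z d → hits (label z) z (suc d) ≡ suc (hits (label z) (suc z) d)
  hits-own z d with label z Fin.≟ label z
  ... | yes _ = refl
  ... | no ≢  = contradiction refl ≢

  hits-other : ∀ {s} z d → s ≢ label z → hits s z (suc d) ≡ hits s (suc z) d
  hits-other {s} z d s≢ with label z Fin.≟ s
  ... | yes eq = contradiction (sym eq) s≢
  ... | no _   = refl

  hits-other-pred : ∀ {s} z d → s ≢ label z → hits s z d ≡ hits s (suc z) (pred d)
  hits-other-pred z zero    _  = refl
  hits-other-pred z (suc d) s≢ = hits-other z d s≢

  hits-shift : ∀ s z d → hits s (z + M) d ≡ hits s z d
  hits-shift s z zero = refl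
  hits-shift s z (suc d) rewrite label-periodic z = cong (_ +_) (hits-shift s (suc z) d)

  Spaced : Vec (Fin q) m → Set
  Spaced x = ∀ s t → s ≢ t → Apart (pos s (lookup x s)) (pos t (lookup x t))

  Spaced? : Decidable Spaced
  Spaced? x = Fin.all? λ s → Fin.all? λ t → ¬? (s Fin.≟ t) →-dec Apart? _ _

  FitsAt : Maybe (Fin q) → ℕ → Fin m → Fin q → Set
  FitsAt (just v) z s w = w ≡ v
  FitsAt nothing  z s w = Between z (pos s w)

  FitsAt? : ∀ a z s w → Dec (FitsAt a z s w)
  FitsAt? (just v) z s w = w Fin.≟ v
  FitsAt? nothing  z s w = Between? z (pos s w)

  Partial : Set
  Partial = Vec (Maybe (Fin q)) m

  Fits : Partial → ℕ → Vec (Fin q) m → Set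
  Fits A z x = ∀ s → FitsAt (lookup A s) z s (lookup x s)

  Fits? : ∀ A z → Decidable (Fits A z)
  Fits? A z x = Fin.all? λ s → FitsAt? (lookup A s) z s (lookup x s)

  Extends? : ∀ A z → Decidable (λ x → Spaced x × Fits A z x)
  Extends? A z x = Spaced? x ×-dec Fits? A z x

  count : Partial → ℕ → ℕ
  count A z = length (filter (Extends? A z) (allPoints q m))

  -- The invariant of the scan. By `ahead`, every position still available is compatible with all
  -- coordinates already placed, so a further placement creates no conflict.
  record Consistent (A : Partial) (z : ℕ) : Set where
    field
      pairwise : ∀ {s t v w} → s ≢ t → lookup A s ≡ just v → lookup A t ≡ just w →
                 Apart (pos s v) (pos t w)
      ahead    : ∀ {s v y} → lookup A s ≡ just v → Between z y → Apart (pos s v) y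
  open Consistent

  -- A full assignment determines a single vector, and consistency makes it spaced.
  count-full : ∀ A z → Consistent A z → openings A ≡ 0 → count A z ≡ 1
  count-full A z ok A-full with x , A≡x ← openings-zero A A-full =
    length-filter-singleton (Extends? A z) (allPoints-unique q m) (∈-allPoints x)
      ((λ s t s≢t → pairwise ok s≢t (A≡x s) (A≡x t)) ,
       λ s → subst (λ a → FitsAt a z s (lookup x s)) (sym (A≡x s)) refl)
      λ {y} (_ , fits) → lookup-ext λ s → subst (λ a → FitsAt a z s (lookup y s)) (A≡x s) (fits s)
    where
    lookup-ext : ∀ {n} {x y : Vec (Fin q) n} → (∀ s → lookup x s ≡ lookup y s) → x ≡ y
    lookup-ext {x = []}    {[]}    _  = refl
    lookup-ext {x = _ ∷ _} {_ ∷ _} eq = cong₂ _∷_ (eq Fin.zero) (lookup-ext (eq ∘ Fin.suc))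

  -- From h on, the interval between z and its mirror image is empty, which leaves no place for an
  -- open coordinate.
  count-stuck : ∀ A z {u} → h ≤ z → openings A ≡ suc u → count A z ≡ 0
  count-stuck A z h≤z open≡ with s , A≡ ← openings-suc A open≡ =
    cong length (List.filter-none (Extends? A z) {xs = allPoints q m} (All.universal (λ x (_ , fits) →
      <⇒≱ (between⇒< (subst (λ a → FitsAt a z s (lookup x s)) A≡ (fits s))) h≤z) _))

  module _ (A : Partial) {z : ℕ} (M≤z : M ≤ z) (z<h : z < h) where

    private
      s₀ = label z
      v₀ = proj₁ (decode z M≤z z<h)
      at-end : AtEnd z (pos s₀ v₀)
      at-end = proj₁ (proj₂ (decode z M≤z z<h))
      at-end-unique = proj₂ (proj₂ (decode z M≤z z<h))

    -- Only `s₀` with value `v₀` can sit at an end of the interval, so a point avoiding this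
    -- survives when both ends move in by one.
    fits-suc : ∀ x → (lookup A s₀ ≡ nothing → lookup x s₀ ≢ v₀) → Fits A z x → Fits A (suc z) x
    fits-suc x avoid fits s with lookup A s in A≡ | fits s
    ... | just _  | fit = fit
    ... | nothing | fit = between-tighten fit λ end → case at-end-unique s _ end of λ where
      (refl , x≡v₀) → avoid A≡ x≡v₀

    fits-weaken : ∀ x → Fits A (suc z) x → Fits A z x
    fits-weaken x fits s with lookup A s | fits s
    ... | just _  | fit = fit
    ... | nothing | fit = between-weaken (n≤1+n z) fit

    private
      A₀ = A [ s₀ ]≔ just v₀

    module _ (open₀ : lookup A s₀ ≡ nothing) where

      -- Once slot z is filled, spacing from `pos s₀ v₀` and from its mirror image moves both ends
      -- in by M for every other open coordinate.
      fits-assign⁺ : ∀ x → Spaced x → Fits A z x → lookup x s₀ ≡ v₀ → Fits A₀ (z + M) x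
      fits-assign⁺ x spaced fits x≡v₀ s with s Fin.≟ s₀
      ... | yes refl = subst (λ a → FitsAt a (z + M) s (lookup x s)) (sym (Vec.lookup∘update s A (just v₀))) x≡v₀
      ... | no s≢ = subst (λ a → FitsAt a (z + M) s (lookup x s)) (sym (Vec.lookup∘update′ s≢ A (just v₀)))
                      (push (lookup A s) (fits s))
        where
        push : ∀ a → FitsAt a z s (lookup x s) → FitsAt a (z + M) s (lookup x s)
        push (just _) fit = fit
        push nothing  fit = apart⇒between (subst (AtEnd z ∘ pos s₀) (sym x≡v₀) at-end) fit
          (m<m+n z 0<M) (spaced s₀ s (s≢ ∘ sym))

      fits-assign⁻ : ∀ x → Fits A₀ (z + M) x → Fits A z x × lookup x s₀ ≡ v₀
      fits-assign⁻ x fits = fits′ , x≡v₀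
        where
        x≡v₀ = subst (λ a → FitsAt a (z + M) s₀ (lookup x s₀)) (Vec.lookup∘update s₀ A (just v₀)) (fits s₀)
        pull : ∀ a {s} → FitsAt a (z + M) s (lookup x s) → FitsAt a z s (lookup x s)
        pull (just _) fit = fit
        pull nothing  fit = between-weaken (m≤m+n z M) fit
        fits′ : Fits A z x
        fits′ s with s Fin.≟ s₀
        ... | yes refl = subst₂ (λ a v → FitsAt a z s v) (sym open₀) (sym x≡v₀) (atEnd⇒between z<h at-end)
        ... | no s≢ = pull (lookup A s) (subst (λ a → FitsAt a (z + M) s (lookup x s))
                        (Vec.lookup∘update′ s≢ A (just v₀)) (fits s))

      fits-suc⇒≢ : ∀ x → Fits A (suc z) x → lookup x s₀ ≢ v₀
      fits-suc⇒≢ x fits x≡v₀ = between-suc⇒¬AtEnd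
        (subst₂ (λ a v → FitsAt a (suc z) s₀ v) open₀ x≡v₀ (fits s₀)) at-end

      -- The split is by whether `s₀` takes the value `v₀`, the only way to occupy slot z.
      count-branch : count A z ≡ count A₀ (z + M) + count A (suc z)
      count-branch = trans (filter-split (Extends? A z) atV₀? (allPoints q m)) (cong₂ _+_
        (length-filter-≐ (λ x → Extends? A z x ×-dec atV₀? x) (Extends? A₀ (z + M))
          ( (λ {x} ((sp , fits) , x≡) → sp , fits-assign⁺ x sp fits x≡)
          , (λ {x} (sp , fits) → let fits′ , x≡ = fits-assign⁻ x fits in (sp , fits′) , x≡)) (allPoints q m))
        (length-filter-≐ (λ x → Extends? A z x ×-dec ¬? (atV₀? x)) (Extends? A (suc z))
          ( (λ {x} ((sp , fits) , x≢) → sp , fits-suc x (λ _ → x≢) fits)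
          , (λ {x} (sp , fits) → (sp , fits-weaken x fits) , fits-suc⇒≢ x fits)) (allPoints q m)))
        where
        atV₀? : Decidable (λ x → lookup x s₀ ≡ v₀)
        atV₀? x = lookup x s₀ Fin.≟ v₀

      -- The new position lies in the interval of z, so `ahead` separates it from all earlier ones;
      -- `atEnd⇒apart` separates it from whatever comes after z + M.
      consistent-assign : Consistent A z → Consistent A₀ (z + M)
      pairwise (consistent-assign ok) s≢t A≡v A≡w with lookup-assign-just A s₀ A≡v | lookup-assign-just A s₀ A≡w
      ... | inj₁ (refl , refl) | inj₁ (refl , refl) = contradiction refl s≢t
      ... | inj₁ (refl , refl) | inj₂ (_ , A≡w′) = apart-sym (ahead ok A≡w′ (atEnd⇒between z<h at-end))
      ... | inj₂ (_ , A≡v′) | inj₁ (refl , refl) = ahead ok A≡v′ (atEnd⇒between z<h at-end)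
      ... | inj₂ (_ , A≡v′) | inj₂ (_ , A≡w′) = pairwise ok s≢t A≡v′ A≡w′
      ahead (consistent-assign ok) A≡v btw with lookup-assign-just A s₀ A≡v
      ... | inj₁ (refl , refl) = atEnd⇒apart at-end btw
      ... | inj₂ (_ , A≡v′) = ahead ok A≡v′ (between-weaken (m≤m+n z M) btw)

    -- The only coordinate that could occupy slot z is already placed.
    count-skip : ∀ {v} → lookup A s₀ ≡ just v → count A z ≡ count A (suc z)
    count-skip A≡v = length-filter-≐ (Extends? A z) (Extends? A (suc z))
      ( (λ {x} (sp , fits) → sp , fits-suc x (λ A≡ → case trans (sym A≡v) A≡ of λ ()) fits)
      , (λ {x} (sp , fits) → sp , fits-weaken x fits)) (allPoints q m)

  consistent-suc : ∀ {A z} → Consistent A z → Consistent A (suc z)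
  pairwise (consistent-suc ok)         = pairwise ok
  ahead    (consistent-suc ok) A≡v btw = ahead ok A≡v (between-weaken (n≤1+n _) btw)

  -- Each of the u open coordinates except one costs M slots.  For u = 0 the value is irrelevant,
  -- as the product over the open coordinates is then empty.
  window : ℕ → ℕ → ℕ
  window z u = h ∸ (z + M * pred u)

  window-suc : ∀ z u → pred (window z u) ≡ window (suc z) u
  window-suc z u = pred[m∸n]≡m∸[1+n] h (z + M * pred u)

  -- A placement moves the start up by M and leaves one coordinate fewer to be charged M, so the
  -- length is preserved.
  window-step : ∀ z u → window (z + M) (suc u) ≡ window z (suc (suc u))
  window-step z u = cong (h ∸_) (trans (+-assoc z M (M * u)) (cong (z +_) (sym (*-suc M u))))

  hits-product : Partial → ℕ → ℕ → ℕ
  hits-product A z d = prodOpen A (λ s → hits s z d)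

  -- The product obeys the recurrence of `count-branch`. Slot z counts for `label z` alone, so the
  -- product expands as (1 + n) * P = P + n * P, where P is the product over the other open
  -- coordinates. By `window-step` and the period M of the labels, P is also the product after the
  -- placement.
  hits-product-branch : ∀ A z v {u} → z < h → lookup A (label z) ≡ nothing → openings (A [ label z ]≔ just v) ≡ u →
    hits-product A z (window z (suc u)) ≡
      hits-product (A [ label z ]≔ just v) (z + M) (window (z + M) u) + hits-product A (suc z) (pred (window z (suc u)))
  hits-product-branch A z v {u} z<h open₀ open≡ with window z (suc u) in window≡
  -- The truncated difference can be 0 although z < h; then every product here with an open
  -- coordinate vanishes.
  ... | zero = trans (prodOpen-zero A _ (openings-assign A v open₀) (λ _ → refl))
      (sym (cong₂ _+_ (empty u open≡ window≡) (prodOpen-zero A _ (openings-assign A v open₀) (λ _ → refl))))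
    where
    empty : ∀ u → openings (A [ label z ]≔ just v) ≡ u → window z (suc u) ≡ 0 →
      hits-product (A [ label z ]≔ just v) (z + M) (window (z + M) u) ≡ 0
    -- With `label z` the only open coordinate, the window is h - z, which is positive.
    empty zero _ eq = contradiction (trans (cong (h ∸_) (sym (trans (cong (z +_) (*-zeroʳ M)) (+-identityʳ z)))) eq)
      (m>n⇒m∸n≢0 z<h)
    empty (suc u) open≡ eq = prodOpen-zero (A [ label z ]≔ just v) _ open≡
      (λ s → cong (hits s (z + M)) (trans (window-step z u) eq))
  ... | suc d = begin
    prodOpen A (λ s → hits s z (suc d))
      ≡⟨ prodOpen-assign A v _ open₀ ⟩
    hits s₀ z (suc d) * prodOpen A₀ (λ s → hits s z (suc d))
      ≡⟨ cong₂ _*_ (hits-own z d) (prodOpen-cong A₀ λ s A₀≡ → hits-other z d (proj₁ (lookup-assign-nothing A s₀ A₀≡))) ⟩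
    prodOpen A₀ (λ s → hits s (suc z) d) + hits s₀ (suc z) d * prodOpen A₀ (λ s → hits s (suc z) d)
      ≡⟨ cong₂ _+_ (shifted u open≡ window≡) (sym (prodOpen-assign A v _ open₀)) ⟩
    hits-product A₀ (z + M) (window (z + M) u) + hits-product A (suc z) d ∎
    where
    open ≡-Reasoning
    s₀ = label z
    A₀ = A [ label z ]≔ just v
    shifted : ∀ u → openings A₀ ≡ u → window z (suc u) ≡ suc d →
      prodOpen A₀ (λ s → hits s (suc z) d) ≡ hits-product A₀ (z + M) (window (z + M) u)
    -- Here the two windows may differ in length, but both products are empty.
    shifted zero    open≡ _  = trans (prodOpen-full A₀ _ open≡) (sym (prodOpen-full A₀ _ open≡))
    shifted (suc u) open≡ eq = prodOpen-cong A₀ λ s A₀≡ → sym (trans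
      (cong (hits s (z + M)) (trans (window-step z u) eq))
      (trans (hits-shift s z (suc d)) (hits-other z d (proj₁ (lookup-assign-nothing A s₀ A₀≡)))))

  -- `fuel` bounds the distance from z to h; the recursion needs it because a placement advances z
  -- by M at once.
  count-formula : ∀ fuel A z → h ≤ fuel + z → M ≤ z → Consistent A z →
    count A z ≡ hits-product A z (window z (openings A))
  count-formula fuel A z h≤ M≤z ok with openings A in open≡
  ... | zero  = trans (count-full A z ok open≡) (sym (prodOpen-full A _ open≡))
  ... | suc u with z <? h
  ... | no z≮h = trans (count-stuck A z h≤z open≡) (sym (prodOpen-zero A _ open≡ λ s →
        cong (hits s z) (m≤n⇒m∸n≡0 (≤-trans h≤z (m≤m+n z _)))))
    where h≤z = ≮⇒≥ z≮h
  count-formula zero A z h≤ M≤z ok | suc u | yes z<h = contradiction h≤ (<⇒≱ z<h)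
  count-formula (suc fuel) A z h≤ M≤z ok | suc u | yes z<h with lookup A (label z) in A≡
  ... | just _ = begin
    count A z                                       ≡⟨ count-skip A M≤z z<h A≡ ⟩
    count A (suc z)                                 ≡⟨ rest ⟩
    hits-product A (suc z) (pred (window z (suc u)))
      -- Slot z is labelled by an assigned coordinate, so dropping it changes no factor of the
      -- product.
      ≡⟨ prodOpen-cong A (λ s A≡′ → sym (hits-other-pred z (window z (suc u))
           λ { refl → case trans (sym A≡) A≡′ of λ () })) ⟩
    hits-product A z (window z (suc u)) ∎
    where
    open ≡-Reasoning
    rest = trans (count-formula fuel A (suc z) (subst (h ≤_) (sym (+-suc fuel z)) h≤) (m≤n⇒m≤1+n M≤z) (consistent-suc ok))
      (cong (hits-product A (suc z)) (trans (cong (window (suc z)) open≡) (sym (window-suc z (suc u)))))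
  ... | nothing = begin
    count A z ≡⟨ count-branch A M≤z z<h A≡ ⟩
    count A₀ (z + M) + count A (suc z) ≡⟨ cong₂ _+_ placed rest ⟩
    hits-product A₀ (z + M) (window (z + M) u) + hits-product A (suc z) (pred (window z (suc u)))
      ≡⟨ sym (hits-product-branch A z v z<h A≡ open≡′) ⟩
    hits-product A z (window z (suc u)) ∎
    where
    open ≡-Reasoning
    v  = proj₁ (decode z M≤z z<h)
    A₀ = A [ label z ]≔ just v
    open≡′ : openings A₀ ≡ u
    open≡′ = suc-injective (trans (sym (openings-assign A v A≡)) open≡)
    h≤′ : h ≤ fuel + suc z
    h≤′ = subst (h ≤_) (sym (+-suc fuel z)) h≤
    rest = trans (count-formula fuel A (suc z) h≤′ (m≤n⇒m≤1+n M≤z) (consistent-suc ok))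
      (cong (hits-product A (suc z)) (trans (cong (window (suc z)) open≡) (sym (window-suc z (suc u)))))
    placed = trans (count-formula fuel A₀ (z + M)
        (≤-trans h≤′ (+-monoʳ-≤ fuel (m<m+n z 0<M))) (≤-trans M≤z (m≤m+n z M))
        (consistent-assign A M≤z z<h A≡ ok))
      (cong (λ u → hits-product A₀ (z + M) (window (z + M) u)) open≡′)

-- Division with remainder and the concrete slots

divMod-unique : ∀ M a b {r r′} → r < M → r′ < M → M * a + r ≡ M * b + r′ → a ≡ b × r ≡ r′
divMod-unique M@(suc _) a b {r} {r′} r<M r′<M eq =
  *-cancelˡ-≡ a b M (+-cancelʳ-≡ r (M * a) (M * b) (trans eq (cong (M * b +_) (sym r≡r′)))) , r≡r′
  where
  rem : ∀ a {r} → r < M → (M * a + r) % M ≡ r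
  rem a {r} r<M = trans (cong (_% M) (trans (+-comm (M * a) r) (cong (r +_) (*-comm M a))))
    (trans ([m+kn]%n≡m%n r a M) (m<n⇒m%n≡m r<M))
  r≡r′ : r ≡ r′
  r≡r′ = trans (sym (rem a r<M)) (trans (cong (_% M) eq) (rem b r′<M))

module Slots (m q : ℕ) (0<m : 0 < m) (2m≤q : 2 * m ≤ q) where

  M h : ℕ
  M = 2 * m
  h = m * suc q

  open Reflection M h

  private instance
    m≢0 : NonZero m
    m≢0 = >-nonZero 0<m
    M≢0 : NonZero M
    M≢0 = m*n≢0 2 m

  0<M : 0 < M
  0<M = >-nonZero⁻¹ M

  pos : Fin m → Fin q → ℕ
  pos s v = M * toℕ v + toℕ s

  label-high-< : ∀ {r} → m ≤ r → M ∸ suc r < m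
  label-high-< {r} m≤r = m<n+o⇒m∸n<o M (suc r) (s≤s (linear 0 m≤r (label-high-<-identity m r)))

  -- As 2h = M(q + 1) is a multiple of M, the mirror image of M v + s is congruent to M - 1 - s.
  -- Residues below m are thus their own label, and a residue r from m on has label M - 1 - r.
  labelAt : ℕ → Fin m
  labelAt r with r <? m
  ... | yes r<m = fromℕ< r<m
  ... | no  r≮m = fromℕ< (label-high-< (≮⇒≥ r≮m))

  labelAt-low : ∀ {r} → r < m → toℕ (labelAt r) ≡ r
  labelAt-low {r} r<m with r <? m
  ... | yes r<m = Fin.toℕ-fromℕ< r<m
  ... | no  r≮m = contradiction r<m r≮m

  labelAt-high : ∀ {r} → m ≤ r → r < M → toℕ (labelAt r) + suc r ≡ M
  labelAt-high {r} m≤r r<M with r <? m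
  ... | yes r<m = contradiction m≤r (<⇒≱ r<m)
  ... | no  r≮m = trans (cong (_+ suc r) (Fin.toℕ-fromℕ< (label-high-< (≮⇒≥ r≮m)))) (m∸n+n≡m r<M)

  label : ℕ → Fin m
  label z = labelAt (z % M)

  label-periodic : ∀ z → label (z + M) ≡ label z
  label-periodic z = cong labelAt ([m+n]%n≡m%n z M)

  toℕ<M : ∀ (s : Fin m) → toℕ s < M
  toℕ<M s = <-≤-trans (Fin.toℕ<n s) (m≤m+n m (m + 0))

  -- Two direct or two mirrored positions agree by uniqueness of division. A direct and a mirrored
  -- one would make M divide s + t + 1, which lies strictly between 0 and M.
  atEnd-unique : ∀ {z} s t v w → AtEnd z (pos s v) → AtEnd z (pos t w) → s ≡ t × v ≡ w
  atEnd-unique {z} s t v w = λ where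
      (inj₁ eq) (inj₁ eq′) → same (trans eq (sym eq′))
      (inj₂ eq) (inj₂ eq′) → same (+-cancelʳ-≡ z _ _ (suc-injective (trans eq (sym eq′))))
      (inj₁ refl) (inj₂ eq′) → mixed s t v w eq′
      (inj₂ eq) (inj₁ refl) → mixed t s w v eq
    where
    same : pos s v ≡ pos t w → s ≡ t × v ≡ w
    same eq with v≡w , s≡t ← divMod-unique M (toℕ v) (toℕ w) (toℕ<M s) (toℕ<M t) eq =
      Fin.toℕ-injective s≡t , Fin.toℕ-injective v≡w
    mixed : ∀ {X : Set} s t v w → suc (pos t w + pos s v) ≡ h + h → X
    mixed s t v w eq with () ← proj₂ (divMod-unique M (toℕ w + toℕ v) (suc q)
      {suc (toℕ t + toℕ s)} {0} (linear 0 (+-mono-≤ (Fin.toℕ<n s) (Fin.toℕ<n t)) (mixed-<-identity m (toℕ s) (toℕ t))) 0<M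
      (trans (mixed-identity m (toℕ w) (toℕ v) (toℕ t) (toℕ s)) (trans eq (h+h-identity m (suc q)))))

  decode : ∀ z → M ≤ z → z < h → ∃ λ v → AtEnd z (pos (label z) v) ×
             (∀ s w → AtEnd z (pos s w) → s ≡ label z × w ≡ v)
  decode z M≤z z<h = proj₁ slot , proj₂ slot , λ s w end′ → atEnd-unique s (label z) w _ end′ (proj₂ slot)
    where
    r = z % M
    j = z / M
    z≡ : z ≡ r + j * M
    z≡ = m≡m%n+[m/n]*n z M
    0<j : 0 < j
    0<j = m≥n⇒m/n>0 M≤z
    -- From j M ≤ z < h, after cancelling m in M = 2m and h = m(q + 1).
    2j≤q : 2 * j ≤ q
    2j≤q = s≤s⁻¹ (*-cancelˡ-< m (2 * j) (suc q) (≤-<-trans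
      (≤-trans (≤-reflexive (half-quotient-identity m j)) (≤-trans (m≤n+m (j * M) r) (≤-reflexive (sym z≡)))) z<h))
    j<q : j < q
    j<q = <-≤-trans (m<m+n j (<-≤-trans 0<j (m≤m+n j 0))) 2j≤q
    low : r < m → ∃ λ v → AtEnd z (pos (label z) v)
    low r<m = fromℕ< j<q , inj₁ (begin
      M * toℕ (fromℕ< j<q) + toℕ (label z) ≡⟨ cong₂ (λ a b → M * a + b) (Fin.toℕ-fromℕ< j<q) (labelAt-low r<m) ⟩
      M * j + r                            ≡⟨ trans (+-comm (M * j) r) (cong (r +_) (*-comm M j)) ⟩
      r + j * M                            ≡⟨ sym z≡ ⟩
      z ∎)
      where open ≡-Reasoning
    -- The mirror image of z = j M + r is M(q - j) + (M - 1 - r), which gives the value q - j. It is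
    -- a residue below q because j > 0, that is, because M ≤ z.
    high : m ≤ r → ∃ λ v → AtEnd z (pos (label z) v)
    high m≤r = fromℕ< q∸j<q , inj₂ (begin
      suc (M * toℕ (fromℕ< q∸j<q) + l + z) ≡⟨ cong₂ (λ a b → suc (M * a + l + b)) (Fin.toℕ-fromℕ< q∸j<q) z≡ ⟩
      suc (M * (q ∸ j) + l + (r + j * M))  ≡⟨ decode-identity M (q ∸ j) j l r ⟩
      M * (q ∸ j + j) + (l + suc r)
        ≡⟨ cong₂ (λ a b → M * a + b) (m∸n+n≡m (<⇒≤ j<q)) (labelAt-high m≤r (m%n<n z M)) ⟩
      M * q + M                            ≡⟨ trans (+-comm (M * q) M) (sym (*-suc M q)) ⟩
      M * suc q                            ≡⟨ sym (trans (h+h-identity m (suc q)) (+-identityʳ (M * suc q))) ⟩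
      h + h ∎)
      where
      open ≡-Reasoning
      l = toℕ (label z)
      q∸j<q : q ∸ j < q
      q∸j<q = ∸-monoʳ-< 0<j (<⇒≤ j<q)
    slot : ∃ λ v → AtEnd z (pos (label z) v)
    slot = [ low , high ]′ (<-≤-connex r m)

  open Placement M h pos label label-periodic 0<M decode public

  hits-+ : ∀ s z d e → hits s z (d + e) ≡ hits s z d + hits s (z + d) e
  hits-+ s z zero    e = cong (λ k → hits s k e) (sym (+-identityʳ z))
  hits-+ s z (suc d) e = begin
    hit s z + hits s (suc z) (d + e)                          ≡⟨ cong (hit s z +_) (hits-+ s (suc z) d e) ⟩
    hit s z + (hits s (suc z) d + hits s (suc (z + d)) e)     ≡⟨ sym (+-assoc (hit s z) _ _) ⟩
    hit s z + hits s (suc z) d + hits s (suc (z + d)) e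
      ≡⟨ cong (λ k → hits s z (suc d) + hits s k e) (sym (+-suc z d)) ⟩
    hits s z (suc d) + hits s (z + suc d) e ∎
    where open ≡-Reasoning

  hits-none : ∀ s z d → (∀ k → k < d → label (z + k) ≢ s) → hits s z d ≡ 0
  hits-none s z zero    miss = refl
  hits-none s z (suc d) miss = trans
    (hits-other z d λ s≡ → miss 0 (s≤s z≤n) (trans (cong label (+-identityʳ z)) (sym s≡)))
    (hits-none s (suc z) d λ k k<d → miss (suc k) (s≤s k<d) ∘ trans (cong label (+-suc z k)))

  hits-once : ∀ s z a b → label (z + a) ≡ s → (∀ k → k < a + suc b → label (z + k) ≡ s → k ≡ a) →
    hits s z (a + suc b) ≡ 1
  hits-once s z a b refl only = begin
    hits s z (a + suc b)                        ≡⟨ hits-+ s z a (suc b) ⟩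
    hits s z a + hits s (z + a) (suc b)
      ≡⟨ cong₂ _+_ (hits-none s z a λ k k<a eq → <⇒≢ k<a (only k (m≤n⇒m≤n+o (suc b) k<a) eq)) (hits-own (z + a) b) ⟩
    suc (hits s (suc (z + a)) b)
      ≡⟨ cong suc (hits-none s (suc (z + a)) b λ k k<b eq → m+1+n≢m a (only (a + suc k) (+-monoʳ-< a (s≤s k<b))
           (trans (cong label (trans (sym (+-assoc z a (suc k))) (+-suc (z + a) k))) eq))) ⟩
    1 ∎
    where open ≡-Reasoning

  label-low : ∀ {k} → k < m → toℕ (label k) ≡ k
  label-low {k} k<m = trans (cong (toℕ ∘ labelAt) (m<n⇒m%n≡m (<-≤-trans k<m (m≤m+n m (m + 0))))) (labelAt-low k<m)

  label-high : ∀ {k} → k < m → toℕ (label (m + k)) + suc k ≡ m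
  label-high {k} k<m = +-cancelʳ-≡ m _ m (begin
      toℕ (label (m + k)) + suc k + m     ≡⟨ +-assoc _ (suc k) m ⟩
      toℕ (label (m + k)) + suc (k + m)   ≡⟨ cong₂ (λ a b → toℕ (labelAt a) + suc b) (m<n⇒m%n≡m mk<M) (+-comm k m) ⟩
      toℕ (labelAt (m + k)) + suc (m + k) ≡⟨ labelAt-high (m≤m+n m k) mk<M ⟩
      M                                   ≡⟨ cong (m +_) (+-identityʳ m) ⟩
      m + m ∎)
    where
    open ≡-Reasoning
    mk<M : m + k < M
    mk<M = +-monoʳ-< m (<-≤-trans k<m (m≤m+n m 0))

  hits-below : ∀ s d → toℕ s < d → d ≤ m → hits s 0 d ≡ 1
  hits-below s d s<d d≤m = subst (λ d → hits s 0 d ≡ 1) s+b≡d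
    (hits-once s 0 (toℕ s) (d ∸ suc (toℕ s)) (Fin.toℕ-injective (label-low (Fin.toℕ<n s)))
      λ k k< eq → trans (sym (label-low (<-≤-trans k< (≤-trans (≤-reflexive s+b≡d) d≤m)))) (cong toℕ eq))
    where
    s+b≡d : toℕ s + suc (d ∸ suc (toℕ s)) ≡ d
    s+b≡d = trans (+-suc (toℕ s) _) (m+[n∸m]≡n s<d)

  hits-above : ∀ s d → d ≤ toℕ s → hits s 0 d ≡ 0
  hits-above s d d≤s = hits-none s 0 d λ k k<d eq → <⇒≢ (<-≤-trans k<d d≤s)
    (trans (sym (label-low (<-trans (<-≤-trans k<d d≤s) (Fin.toℕ<n s)))) (cong toℕ eq))

  -- A period consists of two blocks, the first with labels ascending from 0 to m - 1, the second
  -- descending; all later blocks repeat these.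
  hits-block : ∀ s j → hits s (m * j) m ≡ 1
  hits-block s zero = subst (λ z → hits s z m ≡ 1) (sym (*-zeroʳ m)) (hits-below s m (Fin.toℕ<n s) ≤-refl)
  hits-block s (suc zero) = subst₂ (λ z d → hits s z d ≡ 1) (sym (*-identityʳ m)) a+s≡m
    (hits-once s m a (toℕ s) (Fin.toℕ-injective (+-cancelʳ-≡ (suc a) _ _ (trans (label-high a<m) (sym s+a≡m))))
      λ k k< eq → suc-injective (+-cancelˡ-≡ (toℕ s) _ _
        (trans (cong (λ t → toℕ t + suc k) (sym eq)) (trans (label-high (<-≤-trans k< (≤-reflexive a+s≡m))) (sym s+a≡m)))))
    where
    -- The offset at which a descending block reaches the label s.
    a = m ∸ suc (toℕ s)
    a+s≡m : a + suc (toℕ s) ≡ m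
    a+s≡m = m∸n+n≡m (Fin.toℕ<n s)
    s+a≡m : toℕ s + suc a ≡ m
    s+a≡m = trans (+-suc (toℕ s) a) (m+[n∸m]≡n (Fin.toℕ<n s))
    a<m : a < m
    a<m = <-≤-trans (m<m+n a (s≤s z≤n)) (≤-reflexive a+s≡m)
  hits-block s (suc (suc j)) = trans (cong (λ z → hits s z m) (two-blocks-identity m j))
    (trans (hits-shift s (m * j) m) (hits-block s j))

  hits-blocks : ∀ s B → hits s 0 (m * B) ≡ B
  hits-blocks s zero    = cong (hits s 0) (*-zeroʳ m)
  hits-blocks s (suc B) = begin
    hits s 0 (m * suc B)                  ≡⟨ cong (hits s 0) (trans (*-suc m B) (+-comm m (m * B))) ⟩
    hits s 0 (m * B + m)                  ≡⟨ hits-+ s 0 (m * B) m ⟩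
    hits s 0 (m * B) + hits s (m * B) m   ≡⟨ cong₂ _+_ (hits-blocks s B) (hits-block s B) ⟩
    B + 1                                 ≡⟨ +-comm B 1 ⟩
    suc B ∎
    where open ≡-Reasoning

-- The scan with one coordinate fixed at 1

module OnePlaced (m q : ℕ) (0<m : 0 < m) (2m≤q : 2 * m ≤ q) (i : Fin m) where

  open Slots m q 0<m 2m≤q public
  open Reflection M h public
  open Consistent

  1<q : 1 < q
  1<q = ≤-trans (*-monoʳ-≤ 2 0<m) 2m≤q

  one : Fin q
  one = fromℕ< 1<q

  toℕ-one : toℕ one ≡ 1
  toℕ-one = Fin.toℕ-fromℕ< 1<q

  start : Partial
  start = Vec.replicate m nothing [ i ]≔ just one

  -- The fixed coordinate fills slot M + i, so the scan resumes M later.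
  i₀ z₀ : ℕ
  i₀ = toℕ i
  z₀ = i₀ + M + M

  one-atEnd : AtEnd (i₀ + M) (pos i one)
  one-atEnd = inj₁ (trans (cong (λ a → M * a + i₀) toℕ-one) (trans (cong (_+ i₀) (*-identityʳ M)) (+-comm M i₀)))

  openings-start : openings start ≡ pred m
  openings-start = cong pred (trans (sym (openings-assign (Vec.replicate m nothing) one (Vec.lookup-replicate i nothing)))
    (openings-replicate m))

  start-assigned : ∀ {s v} → lookup start s ≡ just v → s ≡ i × v ≡ one
  start-assigned {s} eq with lookup-assign-just (Vec.replicate m nothing) i eq
  ... | inj₁ found = found
  ... | inj₂ (_ , eq′) = case trans (sym (Vec.lookup-replicate s nothing)) eq′ of λ ()

  start-consistent : Consistent start z₀
  pairwise start-consistent s≢t s≡ t≡ =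
    contradiction (trans (proj₁ (start-assigned s≡)) (sym (proj₁ (start-assigned t≡)))) s≢t
  ahead start-consistent s≡ btw with refl , refl ← start-assigned s≡ = atEnd⇒apart one-atEnd btw

  w₀ : ℕ
  w₀ = window z₀ (pred m)

  -- The two copies of M in `z₀` and the m - 2 charges of M take m M from h = m(q + 1). Restoring
  -- the i slots before the window leaves exactly q - M + 1 blocks. The hypothesis `1 < m` makes the
  -- double predecessor equal to m - 2.
  window-start : 1 < m → i₀ + w₀ ≡ m * suc (q ∸ M)
  window-start 1<m = begin
    i₀ + (h ∸ (z₀ + M * pred (pred m)))  ≡⟨ cong (λ k → i₀ + (h ∸ k)) offset ⟩
    i₀ + (h ∸ (m * M + i₀))              ≡⟨ cong (i₀ +_) (sym (∸-+-assoc h (m * M) i₀)) ⟩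
    i₀ + (h ∸ m * M ∸ i₀)
      ≡⟨ cong (λ k → i₀ + (k ∸ i₀)) (trans (sym (*-distribˡ-∸ m (suc q) M)) (cong (m *_) (+-∸-assoc 1 2m≤q))) ⟩
    i₀ + (m * suc (q ∸ M) ∸ i₀)          ≡⟨ m+[n∸m]≡n (≤-trans (<⇒≤ (Fin.toℕ<n i)) (m≤m*n m (suc (q ∸ M)))) ⟩
    m * suc (q ∸ M) ∎
    where
    open ≡-Reasoning
    2+pred-pred : ∀ {k} → 1 < k → suc (suc (pred (pred k))) ≡ k
    2+pred-pred (s≤s (s≤s _)) = refl
    offset : z₀ + M * pred (pred m) ≡ m * M + i₀
    offset = trans (offset-identity M i₀ (pred (pred m))) (cong (λ k → k * M + i₀) (2+pred-pred 1<m))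

  -- `z₀` is i plus two periods, so the window can be moved down to start at i. Together with the
  -- prefix of the first i slots it forms complete blocks, each with one slot of `s`.
  hits-start : ∀ s → 1 < m → hits s 0 i₀ + hits s z₀ w₀ ≡ suc (q ∸ M)
  hits-start s 1<m = begin
    hits s 0 i₀ + hits s z₀ w₀
      ≡⟨ cong (hits s 0 i₀ +_) (trans (hits-shift s (i₀ + M) w₀) (hits-shift s i₀ w₀)) ⟩
    hits s 0 i₀ + hits s i₀ w₀     ≡⟨ sym (hits-+ s 0 i₀ w₀) ⟩
    hits s 0 (i₀ + w₀)             ≡⟨ cong (hits s 0) (window-start 1<m) ⟩
    hits s 0 (m * suc (q ∸ M))     ≡⟨ hits-blocks s (suc (q ∸ M)) ⟩
    suc (q ∸ M) ∎
    where open ≡-Reasoning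

  count-start : count start z₀ ≡ (q ∸ M) ^ i₀ * (q ∸ M + 1) ^ (m ∸ suc i₀)
  count-start = begin
    count start z₀
      ≡⟨ count-formula h start z₀ (m≤m+n h z₀) (m≤n+m M (i₀ + M)) start-consistent ⟩
    hits-product start z₀ (window z₀ (openings start))
      ≡⟨ cong (λ u → hits-product start z₀ (window z₀ u)) openings-start ⟩
    hits-product start z₀ w₀
      ≡⟨ prodOpen-all-but-one i one _ _ _ below above ⟩
    (q ∸ M) ^ i₀ * (q ∸ M + 1) ^ (m ∸ suc i₀) ∎
    where
    open ≡-Reasoning
    two : ∀ {s t : Fin m} → toℕ s < toℕ t → 1 < m
    two {s} {t} s<t = ≤-<-trans (≤-trans (s≤s z≤n) s<t) (Fin.toℕ<n t)
    -- The prefix contains the label s exactly when s < i; this is the difference of one between the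
    -- two bases.
    below : ∀ s → toℕ s < i₀ → hits s z₀ w₀ ≡ q ∸ M
    below s s<i = suc-injective (trans (cong (_+ hits s z₀ w₀) (sym (hits-below s i₀ s<i (<⇒≤ (Fin.toℕ<n i)))))
      (hits-start s (two {s} {i} s<i)))
    above : ∀ s → i₀ < toℕ s → hits s z₀ w₀ ≡ q ∸ M + 1
    above s i<s = trans (cong (_+ hits s z₀ w₀) (sym (hits-above s i₀ (<⇒≤ i<s))))
      (trans (hits-start s (two {i} {s} i<s)) (+-comm 1 (q ∸ M)))

-- Imported only here: +_ makes the sections (n +_) above ambiguous.
import Data.Integer as ℤ
open ℤ using (ℤ; +_; _⊖_; ∣_∣)
open import Data.Integer.DivMod using (_%ℕ_; _/ℕ_; a≡a%ℕn+[a/ℕn]*n)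
import Data.Integer.Properties as ℤ
open import Data.Nat.Divisibility using (_∣_; divides; ∣⇒≤)

-- Spacing and the conditions on representatives

Separated : ℕ → ℕ → ℕ → Set
Separated q a b = a ≢ b × a ≢ b + 1 × a + b ≢ q × a + b ≢ suc q

module _ (m q : ℕ) where

  open Reflection (2 * m) (m * suc q)

  -- The labels s < t break ties: for b = a + 1 the distance M + t - s suffices, for a = b + 1 the
  -- distance M + s - t does not, matching the asymmetry of x_s - x_t = 1. The signed distance to
  -- the mirror image is M(a + b - q - 1) + s + t + 1 with 0 < s + t + 1 < M, so it is too short
  -- exactly when a + b is q or q + 1.
  separated⇒apart : ∀ a b {s t} → s < t → t < m → Separated q a b → Apart (2 * m * a + s) (2 * m * b + t)
  separated⇒apart a b {s} {t} s<t t<m (a≢b , a≢b+1 , ≢q , ≢1+q) = gap , mirror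
    where
    M = 2 * m
    m≤M : m ≤ M
    m≤M = m≤m+n m (m + 0)
    gap : M * a + s + M ≤ M * b + t ⊎ M * b + t + M ≤ M * a + s
    gap with <-cmp a b
    ... | tri< a<b _ _ = inj₁ (linear 0 (+-mono-≤ (*-monoʳ-≤ M a<b) (<⇒≤ s<t)) (separated-identity₁ M a b s t))
    ... | tri≈ _ a≡b _ = contradiction a≡b a≢b
    ... | tri> _ _ b<a = inj₂ (linear s (+-mono-≤ (*-monoʳ-≤ M 1+b<a) (≤-trans (<⇒≤ t<m) m≤M))
                           (separated-identity₂ M a b s t))
      where
      1+b<a : suc b < a
      1+b<a = ≤∧≢⇒< b<a λ eq → a≢b+1 (trans (sym eq) (+-comm 1 b))
    mirror : M * a + s + (M * b + t) + M < m * suc q + m * suc q ⊎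
             m * suc q + m * suc q + M ≤ suc (M * a + s + (M * b + t))
    mirror with <-cmp (a + b) q
    ... | tri< lt _ _ = inj₁ (linear 1 (+-mono-≤ (*-monoʳ-≤ M lt) (+-mono-≤ (<-trans s<t t<m) t<m))
                           (separated-identity₃ m q a b s t))
    ... | tri≈ _ eq _ = contradiction eq ≢q
    ... | tri> _ _ gt = inj₂ (linear (suc (s + t)) (*-monoʳ-≤ M (≤∧≢⇒< gt (≢1+q ∘ sym)))
                           (separated-identity₄ m q a b s t))

  apart⇒separated : ∀ a b {s t} → s < t → t < m → Apart (2 * m * a + s) (2 * m * b + t) → Separated q a b
  apart⇒separated a b {s} {t} s<t t<m (gap , mirror) = ≢₀ , ≢₁ , ≢₂ , ≢₃
    where
    M = 2 * m
    s<m : s < m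
    s<m = <-trans s<t t<m
    ≢₀ : a ≢ b
    ≢₀ refl = [ (λ le → infeasible (s + m) (+-mono-≤ le t<m) (apart-identity₁ m a s t))
              , (λ le → infeasible M (+-mono-≤ le s<t) (apart-identity₂ M a s t)) ]′ gap
    ≢₁ : a ≢ b + 1
    ≢₁ a≡ with refl ← trans a≡ (+-comm b 1) =
      [ (λ le → infeasible (m + m + m + s) (+-mono-≤ le t<m) (apart-identity₃ m b s t))
      , (λ le → infeasible 0 (+-mono-≤ le s<t) (apart-identity₄ M b s t)) ]′ gap
    ≢₂ : a + b ≢ q
    ≢₂ refl = [ (λ lt → infeasible (s + t) lt (apart-identity₅ m a b s t))
              , (λ le → infeasible (m + m) (+-mono-≤ le (+-mono-≤ s<m t<m)) (apart-identity₆ m a b s t)) ]′ mirror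
    ≢₃ : a + b ≢ suc q
    ≢₃ eq =
      [ (λ lt → infeasible (s + t + M) (subst (λ k → suc (M * a + s + (M * b + t) + M) ≤ m * k + m * k) (sym eq) lt)
                  (apart-identity₇ m a b s t))
      , (λ le → infeasible 0 (+-mono-≤ (subst (λ k → m * k + m * k + M ≤ suc (M * a + s + (M * b + t))) (sym eq) le)
                  (+-mono-≤ s<m t<m)) (apart-identity₈ m a b s t)) ]′ mirror

-- Divisibility and reduction modulo q

⊖-%ℕ : ∀ q .{{_ : NonZero q}} b k → (b + k * q ⊖ b) %ℕ q ≡ 0
⊖-%ℕ q b k rewrite ℤ.⊖-≥ (m≤m+n b (k * q)) | m+n∸m≡n b (k * q) = m*n%n≡0 k q

%ℕ≡0⇒∣ : ∀ q .{{_ : NonZero q}} e → e %ℕ q ≡ 0 → q ∣ ∣ e ∣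
%ℕ≡0⇒∣ q e eq = divides ∣ e /ℕ q ∣ (begin
  ∣ e ∣                                   ≡⟨ cong ∣_∣ (a≡a%ℕn+[a/ℕn]*n e q) ⟩
  ∣ + (e %ℕ q) ℤ.+ (e /ℕ q) ℤ.* + q ∣     ≡⟨ cong (λ r → ∣ + r ℤ.+ (e /ℕ q) ℤ.* + q ∣) eq ⟩
  ∣ + 0 ℤ.+ (e /ℕ q) ℤ.* + q ∣            ≡⟨ cong ∣_∣ (ℤ.+-identityˡ ((e /ℕ q) ℤ.* + q)) ⟩
  ∣ (e /ℕ q) ℤ.* + q ∣                    ≡⟨ ℤ.abs-* (e /ℕ q) (+ q) ⟩
  ∣ e /ℕ q ∣ * q ∎)
  where open ≡-Reasoning

∣∸∣ : ∀ {a b} → b ≤ a → ∣ a ⊖ b ∣ ≡ a ∸ b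
∣∸∣ {a} {b} b≤a = trans (ℤ.∣m⊖n∣≡∣n⊖m∣ a b) (ℤ.∣⊖∣-≤ b≤a)

∣∧<⇒≡0 : ∀ {q n} → q ∣ n → n < q → n ≡ 0
∣∧<⇒≡0 {n = zero}  _   _   = refl
∣∧<⇒≡0 {n = suc n} q∣n n<q = contradiction (∣⇒≤ q∣n) (<⇒≱ n<q)

∣⊖∣-small : ∀ {q a b} → q ∣ ∣ a ⊖ b ∣ → a < b + q → b < a + q → a ≡ b
∣⊖∣-small {q} {a} {b} q∣ a<b+q b<a+q with ≤-total b a
... | inj₁ b≤a = ≤-antisym (m∸n≡0⇒m≤n (∣∧<⇒≡0 (subst (q ∣_) (∣∸∣ b≤a) q∣)
                   (+-cancelˡ-< b _ _ (subst (_< b + q) (sym (m+[n∸m]≡n b≤a)) a<b+q)))) b≤a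
... | inj₂ a≤b = ≤-antisym a≤b (m∸n≡0⇒m≤n (∣∧<⇒≡0 (subst (q ∣_) (ℤ.∣⊖∣-≤ a≤b) q∣)
                   (+-cancelˡ-< a _ _ (subst (_< a + q) (sym (m+[n∸m]≡n a≤b)) b<a+q))))

-- The difference lies strictly between 0 and 2q, where q is the only multiple of q.
∣⊖∣-once : ∀ {q a b} → q ∣ ∣ a ⊖ b ∣ → b < a → a < b + (q + q) → a ≡ b + q
∣⊖∣-once {q} {a} {b} q∣ b<a a< with subst (q ∣_) (∣∸∣ (<⇒≤ b<a)) q∣
... | divides zero eq = contradiction eq (m>n⇒m∸n≢0 b<a)
... | divides (suc zero) eq = trans (sym (m+[n∸m]≡n (<⇒≤ b<a))) (cong (_+_ b) (trans eq (+-identityʳ q)))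
... | divides (suc (suc k)) eq = contradiction
  (≤-trans (+-monoʳ-≤ b (≤-trans (+-monoʳ-≤ q (m≤m+n q (k * q))) (≤-reflexive (sym eq))))
    (≤-reflexive (m+[n∸m]≡n (<⇒≤ b<a))))
  (<⇒≱ a<)

-- Evaluating hyperplanes and testing membership

module _ {q : ℕ} where

  coord : ∀ {m} → Vec (Fin q) m → Fin m → ℕ
  coord x s = toℕ (lookup x s)

  evalH-zero : ∀ {m} b (x : Vec (Fin q) m) → evalH (Vec.replicate m (+ 0) , b) x ≡ ℤ.- b
  evalH-zero b []      = refl
  evalH-zero b (a ∷ x) = trans (ℤ.+-identityˡ _) (evalH-zero b x)

  evalH-unit : ∀ {m} (s : Fin m) a b (x : Vec (Fin q) m) →
    evalH (unit s a , b) x ≡ a ℤ.* + coord x s ℤ.- b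
  evalH-unit Fin.zero    a b (v ∷ x) = cong (ℤ._+_ (a ℤ.* + toℕ v)) (evalH-zero b x)
  evalH-unit (Fin.suc s) a b (v ∷ x) = trans (ℤ.+-identityˡ _) (evalH-unit s a b x)

  evalH-pair : ∀ {m} {s t : Fin m} → s Fin.< t → ∀ c b (x : Vec (Fin q) m) →
    evalH (pair s t c , b) x ≡ + coord x s ℤ.+ (c ℤ.* + coord x t ℤ.- b)
  evalH-pair {s = Fin.zero}  {Fin.suc t} _         c b (v ∷ x) = cong₂ ℤ._+_ (ℤ.*-identityˡ (+ toℕ v)) (evalH-unit t c b x)
  evalH-pair {s = Fin.suc s} {Fin.suc t} (s≤s s<t) c b (v ∷ x) = trans (ℤ.+-identityˡ _) (evalH-pair s<t c b x)

  evalH-axis : ∀ {m} (s : Fin m) b (x : Vec (Fin q) m) → evalH (unit s (+ 1) , + b) x ≡ coord x s ⊖ b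
  evalH-axis s b x = trans (evalH-unit s (+ 1) (+ b) x)
    (trans (cong (ℤ._- + b) (ℤ.*-identityˡ (+ coord x s))) (ℤ.m-n≡m⊖n (coord x s) b))

  evalH-sum : ∀ {m} {s t : Fin m} → s Fin.< t → ∀ b (x : Vec (Fin q) m) →
    evalH (pair s t (+ 1) , + b) x ≡ (coord x s + coord x t) ⊖ b
  evalH-sum {s = s} {t} s<t b x = begin
    evalH (pair s t (+ 1) , + b) x                             ≡⟨ evalH-pair s<t (+ 1) (+ b) x ⟩
    + coord x s ℤ.+ (+ 1 ℤ.* + coord x t ℤ.- + b)
      ≡⟨ cong (λ e → + coord x s ℤ.+ (e ℤ.- + b)) (ℤ.*-identityˡ (+ coord x t)) ⟩
    + coord x s ℤ.+ (+ coord x t ℤ.- + b)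
      ≡⟨ cong (ℤ._+_ (+ coord x s)) (ℤ.m-n≡m⊖n (coord x t) b) ⟩
    + coord x s ℤ.+ (coord x t ⊖ b)                            ≡⟨ ℤ.distribʳ-⊖-+-pos (coord x s) (coord x t) b ⟩
    (coord x s + coord x t) ⊖ b ∎
    where open ≡-Reasoning

  evalH-diff : ∀ {m} {s t : Fin m} → s Fin.< t → ∀ b (x : Vec (Fin q) m) →
    evalH (pair s t (ℤ.- + 1) , + b) x ≡ coord x s ⊖ (coord x t + b)
  evalH-diff {s = s} {t} s<t b x = begin
    evalH (pair s t (ℤ.- + 1) , + b) x                         ≡⟨ evalH-pair s<t (ℤ.- + 1) (+ b) x ⟩
    + coord x s ℤ.+ (ℤ.- + 1 ℤ.* + coord x t ℤ.- + b)
      ≡⟨ cong (λ e → + coord x s ℤ.+ (e ℤ.- + b)) (ℤ.-1*i≡-i (+ coord x t)) ⟩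
    + coord x s ℤ.+ (ℤ.- + coord x t ℤ.- + b)
      ≡⟨ cong (ℤ._+_ (+ coord x s)) (sym (ℤ.neg-distrib-+ (+ coord x t) (+ b))) ⟩
    + coord x s ℤ.- + (coord x t + b)                          ≡⟨ ℤ.m-n≡m⊖n (coord x s) (coord x t + b) ⟩
    coord x s ⊖ (coord x t + b) ∎
    where open ≡-Reasoning

module _ {m q : ℕ} .{{_ : NonZero q}} (x : Vec (Fin q) m) where

  coord<q : ∀ s → coord x s < q
  coord<q s = Fin.toℕ<n (lookup x s)

  ∈-axis⁺ : ∀ s b → coord x s ≡ b → x ∈Hq (unit s (+ 1) , + b)
  ∈-axis⁺ s b eq = trans (cong (_%ℕ q) (trans (evalH-axis s b x)
    (cong (_⊖ b) (trans eq (sym (+-identityʳ b)))))) (⊖-%ℕ q b 0)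

  ∈-axis⁻ : ∀ s b → b < q → x ∈Hq (unit s (+ 1) , + b) → coord x s ≡ b
  ∈-axis⁻ s b b<q on = ∣⊖∣-small (%ℕ≡0⇒∣ q (coord x s ⊖ b) (trans (cong (_%ℕ q) (sym (evalH-axis s b x))) on))
    (<-≤-trans (coord<q s) (m≤n+m q b)) (<-≤-trans b<q (m≤n+m q _))

  module _ {s t : Fin m} (s<t : s Fin.< t) where

    ∈-sum⁺ : ∀ b → coord x s + coord x t ≡ b + q → x ∈Hq (pair s t (+ 1) , + b)
    ∈-sum⁺ b eq = trans (cong (_%ℕ q) (trans (evalH-sum s<t b x)
      (cong (_⊖ b) (trans eq (cong (_+_ b) (sym (+-identityʳ q))))))) (⊖-%ℕ q b 1)

    -- The lower bound rules out equality with `b` itself, and the sum stays below 2q, so exactly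
    -- one wrap-around occurs.
    ∈-sum⁻ : ∀ b → b < coord x s + coord x t → x ∈Hq (pair s t (+ 1) , + b) → coord x s + coord x t ≡ b + q
    ∈-sum⁻ b b< on = ∣⊖∣-once
      (%ℕ≡0⇒∣ q ((coord x s + coord x t) ⊖ b) (trans (cong (_%ℕ q) (sym (evalH-sum s<t b x))) on)) b<
      (<-≤-trans (+-mono-< (coord<q s) (coord<q t)) (m≤n+m (q + q) b))

    ∈-diff⁺ : ∀ b → coord x s ≡ coord x t + b → x ∈Hq (pair s t (ℤ.- + 1) , + b)
    ∈-diff⁺ b eq = trans (cong (_%ℕ q) (trans (evalH-diff s<t b x)
      (cong (_⊖ (coord x t + b)) (trans eq (sym (+-identityʳ _)))))) (⊖-%ℕ q (coord x t + b) 0)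

    -- A wrap-around would require x_s = 0, x_t = q - 1 and b = 1, which a nonzero x_s prevents.
    ∈-diff⁻ : ∀ b → b ≤ 1 → 0 < coord x s → x ∈Hq (pair s t (ℤ.- + 1) , + b) → coord x s ≡ coord x t + b
    ∈-diff⁻ b b≤1 0<s on = ∣⊖∣-small
      (%ℕ≡0⇒∣ q (coord x s ⊖ (coord x t + b)) (trans (cong (_%ℕ q) (sym (evalH-diff s<t b x))) on))
      (<-≤-trans (coord<q s) (m≤n+m q _))
      (≤-<-trans (+-monoʳ-≤ (coord x t) b≤1)
        (≤-<-trans (≤-trans (≤-reflexive (+-comm (coord x t) 1)) (coord<q t)) (m<n+m q 0<s)))

-- Members of the arrangement

data Shi {m : ℕ} : Hyperplane m → Set where
  axis : ∀ s (b : Fin 2) → Shi (unit s (+ 1) , + toℕ b)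
  sum  : ∀ {s t} → s Fin.< t → (b : Fin 2) → Shi (pair s t (+ 1) , + toℕ b)
  diff : ∀ {s t} → s Fin.< t → (b : Fin 2) → Shi (pair s t (ℤ.- + 1) , + toℕ b)

∈-pairsLt⁺ : ∀ {m} {s t : Fin m} → s Fin.< t → (s , t) ∈ pairsLt m
∈-pairsLt⁺ {m} {s} {t} s<t = ∈-filter⁺ (λ p → proj₁ p Fin.<? proj₂ p)
  (∈-concatMap⁺ _ (lose (∈-allFin s) (∈-map⁺ _ (∈-allFin t)))) s<t

∈-shiB⁺ : ∀ {m H} → Shi {m} H → H ∈ shiB m
∈-shiB⁺ (axis s Fin.zero)           = ∈-++⁺ˡ (∈-concatMap⁺ _ (lose (∈-allFin s) (here refl)))
∈-shiB⁺ (axis s (Fin.suc Fin.zero)) = ∈-++⁺ˡ (∈-concatMap⁺ _ (lose (∈-allFin s) (there (here refl))))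
∈-shiB⁺ (sum s<t Fin.zero)            = ∈-++⁺ʳ _ (∈-concatMap⁺ _ (lose (∈-pairsLt⁺ s<t) (here refl)))
∈-shiB⁺ (sum s<t (Fin.suc Fin.zero))  = ∈-++⁺ʳ _ (∈-concatMap⁺ _ (lose (∈-pairsLt⁺ s<t) (there (here refl))))
∈-shiB⁺ (diff s<t Fin.zero)           = ∈-++⁺ʳ _ (∈-concatMap⁺ _ (lose (∈-pairsLt⁺ s<t) (there (there (here refl)))))
∈-shiB⁺ (diff s<t (Fin.suc Fin.zero)) = ∈-++⁺ʳ _ (∈-concatMap⁺ _ (lose (∈-pairsLt⁺ s<t) (there (there (there (here refl))))))

axes : ∀ m → List (Hyperplane m)
axes m = List.concatMap (λ s → (unit s (+ 1) , + 0) ∷ (unit s (+ 1) , + 1) ∷ []) (allFin m)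

∈-pairsLt⁻ : ∀ {m} {s t : Fin m} → (s , t) ∈ pairsLt m → s Fin.< t
∈-pairsLt⁻ {m} st∈ = proj₂ (∈-filter⁻ (λ p → proj₁ p Fin.<? proj₂ p)
  {xs = List.concatMap (λ s → List.map (s ,_) (allFin m)) (allFin m)} st∈)

∈-shiB⁻ : ∀ {m H} → H ∈ shiB m → Shi {m} H
∈-shiB⁻ {m} H∈ with ∈-++⁻ (axes m) H∈
... | inj₁ H∈axes with find (∈-concatMap⁻ _ {xs = allFin m} H∈axes)
...   | s , _ , here refl         = axis s Fin.zero
...   | s , _ , there (here refl) = axis s (Fin.suc Fin.zero)
∈-shiB⁻ {m} H∈ | inj₂ H∈pairs with find (∈-concatMap⁻ _ {xs = pairsLt m} H∈pairs)
... | _ , st∈ , here refl                         = sum (∈-pairsLt⁻ st∈) Fin.zero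
... | _ , st∈ , there (here refl)                 = sum (∈-pairsLt⁻ st∈) (Fin.suc Fin.zero)
... | _ , st∈ , there (there (here refl))         = diff (∈-pairsLt⁻ st∈) Fin.zero
... | _ , st∈ , there (there (there (here refl))) = diff (∈-pairsLt⁻ st∈) (Fin.suc Fin.zero)

lookup-unit : ∀ {m} (s : Fin m) a → lookup (unit s a) s ≡ a
lookup-unit {m} s a = Vec.lookup∘updateAt s {λ _ → a} (Vec.replicate m (+ 0))

lookup-unit-other : ∀ {m} {s t : Fin m} a → t ≢ s → lookup (unit s a) t ≡ + 0
lookup-unit-other {m} {s} {t} a t≢s =
  trans (Vec.lookup∘updateAt′ t s {λ _ → a} t≢s (Vec.replicate m (+ 0))) (Vec.lookup-replicate t (+ 0))

-- A pair has two nonzero coefficients, so its hyperplane is never `coordOne i` and remains in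
-- `shiBWithout`.
pair≢unit : ∀ {m} {s t : Fin m} i {c a} → s Fin.< t → c ≢ + 0 → pair s t c ≢ unit i a
pair≢unit {s = s} {t} i {c} {a} s<t c≢0 eq with t Fin.≟ i
... | no t≢i = c≢0 (trans (sym (Vec.lookup∘updateAt t {λ _ → c} (unit s (+ 1))))
                 (trans (cong (λ v → lookup v t) eq) (lookup-unit-other a t≢i)))
... | yes refl = case trans (sym pair-s) (trans (cong (λ v → lookup v s) eq) (lookup-unit-other a s≢t)) of λ ()
  where
  s≢t : s ≢ t
  s≢t s≡t = <⇒≢ s<t (cong toℕ s≡t)
  pair-s : lookup (pair s t c) s ≡ + 1
  pair-s = trans (Vec.lookup∘updateAt′ s t {λ _ → c} s≢t (unit s (+ 1))) (lookup-unit s (+ 1))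

-- The restriction as a placement problem

module _ (m q : ℕ) .{{_ : NonZero q}} (0<m : 0 < m) (2m≤q : 2 * m ≤ q) (i : Fin m) where

  open OnePlaced m q 0<m 2m≤q i

  InRestriction : Vec (Fin q) m → Set
  InRestriction x = (x ∈Hq coordOne i) × All (λ H → ¬ (x ∈Hq H)) (shiBWithout m (coordOne i))

  InRestriction? : Decidable InRestriction
  InRestriction? x = (x ∈Hq? coordOne i) ×-dec All.all? (λ H → ¬? (x ∈Hq? H)) (shiBWithout m (coordOne i))

  restriction⇒placed : ∀ {x} → InRestriction x → Spaced x × Fits start z₀ x
  restriction⇒placed {x} (on , avoid) = spaced , fits
    where
    ∉ : ∀ {H} → Shi H → H ≢ coordOne i → ¬ (x ∈Hq H)
    ∉ shi H≢ = All.lookup avoid (∈-filter⁺ (λ H → ¬? (H ≟H coordOne i)) (∈-shiB⁺ shi) H≢)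
    0<coord : ∀ s → 0 < coord x s
    0<coord s = n≢0⇒n>0 λ eq → ∉ (axis s Fin.zero) (λ eq → case cong proj₂ eq of λ ()) (∈-axis⁺ x s 0 eq)
    separated : ∀ {s t} → s Fin.< t → Separated q (coord x s) (coord x t)
    separated s<t =
      (λ eq → ∉ (diff s<t Fin.zero) (pair≢unit i s<t (λ ()) ∘ cong proj₁)
              (∈-diff⁺ x s<t 0 (trans eq (sym (+-identityʳ _))))) ,
      (λ eq → ∉ (diff s<t (Fin.suc Fin.zero)) (pair≢unit i s<t (λ ()) ∘ cong proj₁) (∈-diff⁺ x s<t 1 eq)) ,
      (λ eq → ∉ (sum s<t Fin.zero) (pair≢unit i s<t (λ ()) ∘ cong proj₁) (∈-sum⁺ x s<t 0 eq)) ,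
      (λ eq → ∉ (sum s<t (Fin.suc Fin.zero)) (pair≢unit i s<t (λ ()) ∘ cong proj₁) (∈-sum⁺ x s<t 1 eq))
    apart : ∀ {s t} → s Fin.< t → Apart (pos s (lookup x s)) (pos t (lookup x t))
    apart {s} {t} s<t = separated⇒apart m q (coord x s) (coord x t) s<t (Fin.toℕ<n t) (separated s<t)
    spaced : Spaced x
    spaced s t s≢t with <-cmp (toℕ s) (toℕ t)
    ... | tri< s<t _ _ = apart s<t
    ... | tri≈ _ s≡t _ = contradiction (Fin.toℕ-injective s≡t) s≢t
    ... | tri> _ _ t<s = apart-sym (apart t<s)
    x-one : lookup x i ≡ one
    x-one = Fin.toℕ-injective (trans (∈-axis⁻ x i 1 1<q on) (sym toℕ-one))
    inside : ∀ s → Between M (pos s (lookup x s))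
    inside s = ≤-trans (m≤m*n M (coord x s) {{>-nonZero (0<coord s)}}) (m≤m+n _ (toℕ s)) ,
      linear 0 (+-mono-≤ (*-monoʳ-≤ M (coord<q x s)) (toℕ<M s)) (inside-identity m q (coord x s) (toℕ s))
    fits : Fits start z₀ x
    fits s with s Fin.≟ i
    ... | yes refl = subst (λ a → FitsAt a z₀ s (lookup x s))
            (sym (Vec.lookup∘update s (Vec.replicate m nothing) (just one))) x-one
    ... | no s≢i = subst (λ a → FitsAt a z₀ s (lookup x s))
            (sym (trans (Vec.lookup∘update′ s≢i (Vec.replicate m nothing) (just one)) (Vec.lookup-replicate s nothing)))
            -- No coordinate is 0, so all positions lie at M or beyond. The fixed slot M + i is less
            -- than M above this bound, and spacing pushes the others past `z₀`.
            (apart⇒between (subst (λ v → AtEnd (i₀ + M) (pos i v)) (sym x-one) one-atEnd) (inside s)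
              (+-monoˡ-< M (toℕ<M i)) (spaced i s (s≢i ∘ sym)))

  placed⇒restriction : ∀ {x} → Spaced x × Fits start z₀ x → InRestriction x
  placed⇒restriction {x} (spaced , fits) =
    ∈-axis⁺ x i 1 coord-i , All.tabulate λ H∈ →
      let H∈shiB , H≢ = ∈-filter⁻ (λ H → ¬? (H ≟H coordOne i)) {xs = shiB m} H∈ in ∉ (∈-shiB⁻ H∈shiB) H≢
    where
    coord-i : coord x i ≡ 1
    coord-i = trans (cong toℕ (subst (λ a → FitsAt a z₀ i (lookup x i))
      (Vec.lookup∘update i (Vec.replicate m nothing) (just one)) (fits i))) toℕ-one
    -- A value of at most 1 would give a position below 2M, whereas `z₀` is at least 2M.
    1<coord : ∀ s → s ≢ i → 1 < coord x s
    1<coord s s≢i = ≰⇒> λ c≤1 → <⇒≱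
      (+-mono-≤-< (≤-trans (*-monoʳ-≤ M c≤1) (≤-reflexive (*-identityʳ M))) (toℕ<M s))
      (≤-trans (+-monoˡ-≤ M (m≤n+m M i₀)) (proj₁ (subst (λ a → FitsAt a z₀ s (lookup x s))
        (trans (Vec.lookup∘update′ s≢i (Vec.replicate m nothing) (just one)) (Vec.lookup-replicate s nothing)) (fits s))))
    0<coord : ∀ s → 0 < coord x s
    0<coord s with s Fin.≟ i
    ... | yes refl = ≤-reflexive (sym coord-i)
    ... | no s≢i   = <⇒≤ (1<coord s s≢i)
    separated : ∀ {s t} → s Fin.< t → Separated q (coord x s) (coord x t)
    separated {s} {t} s<t = apart⇒separated m q (coord x s) (coord x t) s<t (Fin.toℕ<n t)
      (spaced s t λ s≡t → <⇒≢ s<t (cong toℕ s≡t))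
    bit≤1 : (b : Fin 2) → toℕ b ≤ 1
    bit≤1 b = s≤s⁻¹ (Fin.toℕ<n b)
    ∉axis : ∀ s b → (unit s (+ 1) , + toℕ b) ≢ coordOne i → coord x s ≢ toℕ b
    ∉axis s b H≢ eq with s Fin.≟ i
    ∉axis s b H≢ eq | no s≢i = <⇒≱ (1<coord s s≢i) (≤-trans (≤-reflexive eq) (bit≤1 b))
    ∉axis s Fin.zero H≢ eq | yes refl = case trans (sym coord-i) eq of λ ()
    -- This is the hyperplane removed from the arrangement.
    ∉axis s (Fin.suc Fin.zero) H≢ eq | yes refl = H≢ refl
    ∉sum : ∀ {s t} → s Fin.< t → (b : Fin 2) → coord x s + coord x t ≢ toℕ b + q
    ∉sum s<t Fin.zero           = proj₁ (proj₂ (proj₂ (separated s<t)))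
    ∉sum s<t (Fin.suc Fin.zero) = proj₂ (proj₂ (proj₂ (separated s<t)))
    ∉diff : ∀ {s t} → s Fin.< t → (b : Fin 2) → coord x s ≢ coord x t + toℕ b
    ∉diff s<t Fin.zero eq        = proj₁ (separated s<t) (trans eq (+-identityʳ _))
    ∉diff s<t (Fin.suc Fin.zero) = proj₁ (proj₂ (separated s<t))
    ∉ : ∀ {H} → Shi H → H ≢ coordOne i → ¬ (x ∈Hq H)
    ∉ (axis s b) H≢ on = ∉axis s b H≢ (∈-axis⁻ x s (toℕ b) (≤-<-trans (bit≤1 b) 1<q) on)
    ∉ (sum {s} {t} s<t b) _ on =
      ∉sum s<t b (∈-sum⁻ x s<t (toℕ b) (≤-<-trans (bit≤1 b) (+-mono-≤ (0<coord s) (0<coord t))) on)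
    ∉ (diff {s} s<t b) _ on = ∉diff s<t b (∈-diff⁻ x s<t (toℕ b) (bit≤1 b) (0<coord s) on)

  restrictionCount-coordOne :
    restrictionCount m q (coordOne i) ≡ (q ∸ 2 * m) ^ toℕ i * (q ∸ 2 * m + 1) ^ (m ∸ suc (toℕ i))
  restrictionCount-coordOne = trans
    (length-filter-≐ InRestriction? (Extends? start z₀) (restriction⇒placed , placed⇒restriction) (allPoints q m))
    count-start

theorem4p1 : (m : ℕ) → 1 ≤ m → (i : Fin m) →
    ∃ λ N → (q : ℕ) .{{_ : NonZero q}} → N ≤ q →
    restrictionCount m q (coordOne i)
    ≡ (q ∸ 2 * m) ^ toℕ i * (q ∸ 2 * m + 1) ^ (m ∸ suc (toℕ i))
-- The bound 2m makes the subtraction `q ∸ 2 * m` exact and, as m is positive, ensures 1 < q.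
theorem4p1 m 1≤m i = 2 * m , λ q 2m≤q → restrictionCount-coordOne m q 1≤m 2m≤q i
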